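{- Let $k\ge 1$ and $n\geq 2$ be integers and let $\alpha$ be the unique positive real root of $\phi(x)=x^3-2kx^2-kx-1$. For every real $r>0$ with $r\neq\alpha^{ -1}$ and $r\neq P_{k,n-1}^{ -n/2}P_{k,n}^{n/2}$, the $r$-circulant matrix $$\mathbf{P}_n=\mathrm{Circ}_r(P_{k,0},P_{k,1},\ldots,P_{k,n-1})$$ is invertible.
   Context: For an integer $k\geq 1$, the generalized $k$-Pell-Tribonacci sequence $(P_{k,n})_{n\ge 0}$ is defined by $P_{k,0}=0$, $P_{k,1}=1$, $P_{k,2}=2k$ and $P_{k,n}=2kP_{k,n-1}+kP_{k,n-2}+P_{k,n-3}$ for $n\geq 3$. Its characteristic polynomial $\phi(x)=x^3-2kx^2-kx-1$ has exactly one positive real root. For $n\ge 2$, $r\in\mathbb{C}$ and $a_0,\dots,a_{n-1}\in\mathbb{C}$, the $r$-circulant matrix $\mathrm{Circ}_r(a_0,\dots,a_{n-1})$ is the $n\times n$ matrix whose $(i,j)$ entry ($1\le i,j\le n$) is $a_{j-i}$ if $j\ge i$ and $r\,a_{n+j-i}$ if $j<i$. -}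

module Defs where

open import Algebra.Apartness.Bundles using (HeytingField; module HeytingCommutativeRing)
open import Algebra.Bundles using (CommutativeRing)
import Algebra.Definitions
import Algebra.Properties.Ring as RingProperties
import Algebra.Properties.Semiring.Exp as Exp
import Algebra.Properties.Semiring.Mult as Mult
import Algebra.Properties.Semiring.Sum as Sum
open import Data.Bool.Base using (if_then_else_)
open import Data.Fin.Base using (Fin; toℕ; fromℕ<)
open import Data.Fin.Properties using (toℕ<n; _≟_)
open import Data.Nat.Base as ℕ using (ℕ; zero; suc; _≤_; _∸_)
import Data.Nat.Properties as ℕ
open import Data.Product.Base using (∃-syntax; _×_; proj₁; proj₂)
open import Data.Sum.Base using (_⊎_; inj₂)
open import Data.Vec.Functional using (Vector)
open import Level using (_⊔_) renaming (suc to lsuc)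
open import Relation.Binary.Core using (Rel)
open import Relation.Binary.Definitions using (Cotransitive)
open import Relation.Binary.Structures using (IsStrictPartialOrder)
open import Relation.Binary.PropositionalEquality.Core using (subst)
open import Relation.Nullary.Decidable.Core using (yes; no; does)

-- The generalized k-Pell-Tribonacci numbers P_{k,n}.

P : ℕ → ℕ → ℕ
P k 0                   = 0
P k 1                   = 1
P k 2                   = 2 ℕ.* k
P k (suc (suc (suc n))) =
  2 ℕ.* k ℕ.* P k (suc (suc n)) ℕ.+ k ℕ.* P k (suc n) ℕ.+ P k n

module SquareMatrix {a ℓ} (R : CommutativeRing a ℓ) where
  open CommutativeRing R
  open Sum semiring using (sum)

  infix  4 _≈ᴹ_
  infixl 7 _*ᴹ_

  Matrix : ℕ → Set a
  Matrix n = Fin n → Fin n → Carrier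

  _≈ᴹ_ : ∀ {n} → Rel (Matrix n) ℓ
  A ≈ᴹ B = ∀ i j → A i j ≈ B i j

  _*ᴹ_ : ∀ {n} → Matrix n → Matrix n → Matrix n
  (A *ᴹ B) i j = sum λ l → A i l * B l j

  1ᴹ : ∀ {n} → Matrix n
  1ᴹ i j = if does (i ≟ j) then 1# else 0#

  IsInvertible : ∀ {n} → Matrix n → Set (a ⊔ ℓ)
  IsInvertible = Algebra.Definitions.Invertible _≈ᴹ_ 1ᴹ _*ᴹ_

  -- Indices run from 0 instead of 1; the entries depend only on j - i.

  Circ : ∀ {n} → Carrier → Vector Carrier n → Matrix n
  Circ {n} r a i j with toℕ i ℕ.≤? toℕ j
  ... | yes _   = a (fromℕ< {toℕ j ∸ toℕ i} (ℕ.≤-<-trans (ℕ.m∸n≤m (toℕ j) (toℕ i)) (toℕ<n j)))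
  ... | no  i≰j = r * a (fromℕ< {(n ℕ.+ toℕ j) ∸ toℕ i} n+j∸i<n)
    where
    n+j∸i<n : (n ℕ.+ toℕ j) ∸ toℕ i ℕ.< n
    n+j∸i<n = subst ((n ℕ.+ toℕ j) ∸ toℕ i ℕ.<_) (ℕ.m+n∸n≡m n (toℕ i))
      (ℕ.∸-monoˡ-< (ℕ.+-monoʳ-< n (ℕ.≰⇒> i≰j))
                   (ℕ.≤-trans (ℕ.<⇒≤ (toℕ<n i)) (ℕ.m≤m+n n (toℕ j))))

-- The real numbers, axiomatised as a Cauchy-complete Archimedean ordered
-- field.  The axioms are constructive: the order is cotransitive rather
-- than trichotomous, and inequality is the tight apartness
-- x # y ⇔ x < y ⊎ y < x.  Classically _#_ is the negation of _≈_, and the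
-- axioms characterise the ordered field ℝ up to unique isomorphism.

record RealNumbers c ℓ₁ ℓ₂ ℓ₃ : Set (lsuc (c ⊔ ℓ₁ ⊔ ℓ₂ ⊔ ℓ₃)) where
  infix 4 _<_
  infix 9 _⁻¹[_]

  field
    heytingField : HeytingField c ℓ₁ ℓ₂

  open HeytingField heytingField public renaming (Carrier to ℝ)

  commutativeRing : CommutativeRing c ℓ₁
  commutativeRing = HeytingCommutativeRing.commutativeRing heytingCommutativeRing

  open CommutativeRing commutativeRing public using (semiring)
  open SquareMatrix commutativeRing public
  open Exp semiring public using (_^_)
  open Mult semiring using () renaming (_×_ to _×ₙ_)

  fromℕ : ℕ → ℝ
  fromℕ n = n ×ₙ 1#

  field
    _<_                    : Rel ℝ ℓ₃
    <-isStrictPartialOrder : IsStrictPartialOrder _≈_ _<_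
    <-cotrans              : Cotransitive _<_
    #⇒<⊎>                  : ∀ {x y} → x # y → x < y ⊎ y < x
    <⊎>⇒#                  : ∀ {x y} → x < y ⊎ y < x → x # y
    +-monoˡ-<              : ∀ {x y} z → x < y → x + z < y + z
    *-positive             : ∀ {x y} → 0# < x → 0# < y → 0# < x * y
    archimedean            : ∀ x → ∃[ n ] x < fromℕ n

  -- ∣ x - y ∣ < ε
  Close : ℝ → ℝ → ℝ → Set ℓ₃
  Close ε x y = x < y + ε × y < x + ε

  Cauchy : (ℕ → ℝ) → Set (c ⊔ ℓ₃)
  Cauchy s = ∀ ε → 0# < ε → ∃[ N ] (∀ m n → N ≤ m → N ≤ n → Close ε (s m) (s n))

  _ConvergesTo_ : (ℕ → ℝ) → ℝ → Set (c ⊔ ℓ₃)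
  s ConvergesTo l = ∀ ε → 0# < ε → ∃[ N ] (∀ n → N ≤ n → Close ε (s n) l)

  field
    complete : ∀ s → Cauchy s → ∃[ l ] s ConvergesTo l

  _⁻¹[_] : ∀ x → 0# < x → ℝ
  x ⁻¹[ 0<x ] = proj₁ (#⇒invertible (<⊎>⇒# (inj₂ 0<x)))

  -- HeytingField supplies the inverse of the difference x - 0# rather than
  -- of x itself.

  ⁻¹-inverseˡ : ∀ x (0<x : 0# < x) → x ⁻¹[ 0<x ] * x ≈ 1#
  ⁻¹-inverseˡ x 0<x = trans (*-congˡ (sym x-0≈x))
                            (proj₁ (proj₂ (#⇒invertible (<⊎>⇒# (inj₂ 0<x)))))
    where
    x-0≈x : x - 0# ≈ x
    x-0≈x = trans (+-congˡ (RingProperties.-0#≈0# (CommutativeRing.ring commutativeRing)))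
                  (+-identityʳ x)

  φ : ℕ → ℝ → ℝ
  φ k x = x ^ 3 - fromℕ (2 ℕ.* k) * x ^ 2 - fromℕ k * x - 1#

  -- y = x^{n/2}, for x > 0.

  IsHalfPower : ℝ → ℕ → ℝ → Set (ℓ₁ ⊔ ℓ₃)
  IsHalfPower x n y = 0# < y × y * y ≈ x ^ n

{-# OPTIONS --safe #-}
-- The matrix is f(E) for the twisted shift E with Eⁿ = r and f = Σ_{m<n} P_m zᵐ, so it
-- suffices that f is a unit in A = ℝ[z]/(zⁿ - r), i.e. that B = A/(f) is trivial.
-- In B the truncated generating function f (1 - 2kz - kz² - z³) = 0 becomes a quadratic
-- equation q(z) = 0; completing the square gives ε = λ₁ z - β with ε² = δ ∈ ℝ.  If δ < 0,
-- both roots have modulus √(P_n/P_{n-1}), and zⁿ = r contradicts the hypothesis on r.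
-- If δ > 0, both roots are real, and they are positive (then f > 0) or less than -1 (then
-- zⁿ < 0 for odd n and f < 0 for even n).
-- Constructively the sign of δ is not decidable, but the norm that settles the first case
-- stays positive for small δ > 0, so cotransitivity of < suffices.  Roots are avoided:
-- positivity at both of them is a property of elements t + y ε of B.

module Submission where

open import Algebra.Bundles using (CommutativeRing)
open import Algebra.Morphism.Construct.Composition using (isRingHomomorphism)
open import Algebra.Morphism.Structures using (IsRingHomomorphism)
import Algebra.Properties.AbelianGroup as AbelianGroupProperties
import Algebra.Properties.CommutativeSemiring.Exp as CommutativeExp
import Algebra.Properties.Ring as RingProperties
import Algebra.Properties.Semiring.Exp as Exp
import Algebra.Properties.Semiring.Mult as Mult
import Algebra.Properties.Semiring.Mult.TCOptimised as MultTC
import Algebra.Properties.Semiring.Sum as Sum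
import Algebra.Solver.Ring as RingSolver
open import Algebra.Solver.Ring.AlmostCommutativeRing
  using (fromCommutativeRing; _-Raw-AlmostCommutative⟶_)
open import Data.Empty using (⊥-elim)
open import Data.Fin.Base using (Fin; zero; suc; toℕ)
import Data.Fin.Properties as Fin
open import Data.Integer.Base as ℤ using (ℤ; +_; -[1+_]; _⊖_; _◃_)
import Data.Integer.Properties as ℤ
open import Data.Maybe.Base using (Maybe; map)
open import Data.Nat.Base as ℕ using (ℕ; zero; suc; _≤_; _∸_; z≤n; s≤s)
open import Data.Nat.Divisibility using (∣-refl)
open import Data.Nat.DivMod using (_/_; _%_; _mod_)
import Data.Nat.DivMod as ℕ
import Data.Nat.Properties as ℕ
open import Data.Product.Base using (∃-syntax; _×_; _,_; proj₁; proj₂)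
open import Data.Sign.Base as Sign using (Sign)
open import Data.Sum.Base as Sum⊎ using (_⊎_; inj₁; inj₂; [_,_]′)
open import Function.Base using (_∘_; id)
open import Level using (_⊔_)
open import Relation.Binary.Consequences using (dec⇒weaklyDec)
open import Relation.Binary.PropositionalEquality.Core as ≡ using (_≡_)
import Relation.Binary.Reasoning.Setoid as SetoidReasoning
open import Relation.Binary.Structures using (IsStrictPartialOrder)
open import Relation.Nullary.Decidable.Core using (yes; no)
open import Relation.Nullary.Negation.Core using (¬_; contradiction)
open import Defs

-- The eigenvalues of the matrix are the values of `f` at the complex solutions of `zⁿ = r`. A
-- classical proof would pick one where `f` vanishes; here the generic one, the class of `z` in `B`,
-- takes its place. Every contradiction then has the same form: some positive real becomes zero in
-- `B`, which forces `1 = 0` there, and the cofactor witnessing this is the inverse of `f`. The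
-- modulus argument becomes a norm computation. In `B`, `(λ₁ z)ⁿ = (β + ε)ⁿ = T + Y ε` with real
-- `T`, `Y`, and multiplicativity of the norm gives `T² - δ Y² = (λ₁ λ₂)ⁿ = W²`. Since `zⁿ = r`, the
-- same power is the real `R′ = λ₁ⁿ r`. Hence `T - R′ + Y ε` is zero in `B`, while its norm is
-- `W² + R′² - 2 R′ T`. If `δ ≤ 0`, then `T ≤ W` and this is at least `(W - R′)²`; the hypothesis on
-- `r` says exactly that `R′` and `W` differ. Because `T² = W² + δ Y²`, a positive `δ` enlarges `T`
-- only in proportion to `δ Y²`, which leaves the margin that cotransitivity needs.

-- Ring solver with integer coefficients

module IntegerCoefficients {c ℓ} (R : CommutativeRing c ℓ) where
  open CommutativeRing R
  open RingProperties ring using (-0#≈0#; -‿distribˡ-*; -‿distribʳ-*)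
  open AbelianGroupProperties +-abelianGroup
    using () renaming (⁻¹-involutive to -‿involutive; ⁻¹-∙-comm to -‿+-comm)
  open MultTC semiring renaming (_×_ to _×ₙ_)
  open SetoidReasoning setoid

  -- With these multiples the integers 0 and 1 evaluate definitionally to `0#` and `1#`, so solved
  -- equations match goals that contain these constants.
  ⟦_⟧ᶻ : ℤ → Carrier
  ⟦ + n ⟧ᶻ      = n ×ₙ 1#
  ⟦ -[1+ n ] ⟧ᶻ = - (suc n ×ₙ 1#)

  [x+y]-[x+z]≈y-z : ∀ x y z → (x + y) - (x + z) ≈ y - z
  [x+y]-[x+z]≈y-z x y z = begin
    (x + y) - (x + z)     ≈⟨ +-congˡ (-‿+-comm x z) ⟨
    (x + y) + (- x - z)   ≈⟨ +-assoc (x + y) (- x) (- z) ⟨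
    ((x + y) - x) - z     ≈⟨ +-congʳ (+-congʳ (+-comm x y)) ⟩
    ((y + x) - x) - z     ≈⟨ +-congʳ (+-assoc y x (- x)) ⟩
    (y + (x - x)) - z     ≈⟨ +-congʳ (+-congˡ (-‿inverseʳ x)) ⟩
    (y + 0#) - z          ≈⟨ +-congʳ (+-identityʳ y) ⟩
    y - z                 ∎

  ⊖-homo : ∀ m n → ⟦ m ⊖ n ⟧ᶻ ≈ m ×ₙ 1# - n ×ₙ 1#
  ⊖-homo zero    zero    = sym (-‿inverseʳ 0#)
  ⊖-homo zero    (suc n) = sym (+-identityˡ _)
  ⊖-homo (suc m) zero    = sym (trans (+-congˡ -0#≈0#) (+-identityʳ _))
  ⊖-homo (suc m) (suc n) = begin
    ⟦ suc m ⊖ suc n ⟧ᶻ                     ≡⟨ ≡.cong ⟦_⟧ᶻ (ℤ.[1+m]⊖[1+n]≡m⊖n m n) ⟩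
    ⟦ m ⊖ n ⟧ᶻ                             ≈⟨ ⊖-homo m n ⟩
    m ×ₙ 1# - n ×ₙ 1#                      ≈⟨ [x+y]-[x+z]≈y-z 1# _ _ ⟨
    (1# + m ×ₙ 1#) - (1# + n ×ₙ 1#)        ≈⟨ +-cong (1+× m 1#) (-‿cong (1+× n 1#)) ⟨
    suc m ×ₙ 1# - suc n ×ₙ 1#              ∎

  +-homo : ∀ i j → ⟦ i ℤ.+ j ⟧ᶻ ≈ ⟦ i ⟧ᶻ + ⟦ j ⟧ᶻ
  +-homo (+ m)    (+ n)    = ×-homo-+ 1# m n
  +-homo (+ m)    -[1+ n ] = ⊖-homo m (suc n)
  +-homo -[1+ m ] (+ n)    = trans (⊖-homo n (suc m)) (+-comm _ _)
  +-homo -[1+ m ] -[1+ n ] = begin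
    - (suc (suc (m ℕ.+ n)) ×ₙ 1#)          ≡⟨ ≡.cong (λ l → - (suc l ×ₙ 1#)) (ℕ.+-suc m n) ⟨
    - ((suc m ℕ.+ suc n) ×ₙ 1#)            ≈⟨ -‿cong (×-homo-+ 1# (suc m) (suc n)) ⟩
    - (suc m ×ₙ 1# + suc n ×ₙ 1#)          ≈⟨ -‿+-comm _ _ ⟨
    - (suc m ×ₙ 1#) - suc n ×ₙ 1#          ∎

  +◃-homo : ∀ n → ⟦ Sign.+ ◃ n ⟧ᶻ ≈ n ×ₙ 1#
  +◃-homo zero    = refl
  +◃-homo (suc n) = refl

  -◃-homo : ∀ n → ⟦ Sign.- ◃ n ⟧ᶻ ≈ - (n ×ₙ 1#)
  -◃-homo zero    = sym -0#≈0#
  -◃-homo (suc n) = refl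

  *-homo : ∀ i j → ⟦ i ℤ.* j ⟧ᶻ ≈ ⟦ i ⟧ᶻ * ⟦ j ⟧ᶻ
  *-homo (+ m)    (+ n)    = trans (+◃-homo (m ℕ.* n)) (×1-homo-* m n)
  *-homo (+ m)    -[1+ n ] = begin
    ⟦ Sign.- ◃ (m ℕ.* suc n) ⟧ᶻ            ≈⟨ -◃-homo (m ℕ.* suc n) ⟩
    - ((m ℕ.* suc n) ×ₙ 1#)                ≈⟨ -‿cong (×1-homo-* m (suc n)) ⟩
    - (m ×ₙ 1# * suc n ×ₙ 1#)              ≈⟨ -‿distribʳ-* _ _ ⟩
    m ×ₙ 1# * - (suc n ×ₙ 1#)              ∎
  *-homo -[1+ m ] (+ n)    = begin
    ⟦ Sign.- ◃ (suc m ℕ.* n) ⟧ᶻ            ≈⟨ -◃-homo (suc m ℕ.* n) ⟩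
    - ((suc m ℕ.* n) ×ₙ 1#)                ≈⟨ -‿cong (×1-homo-* (suc m) n) ⟩
    - (suc m ×ₙ 1# * n ×ₙ 1#)              ≈⟨ -‿distribˡ-* _ _ ⟩
    - (suc m ×ₙ 1#) * n ×ₙ 1#              ∎
  *-homo -[1+ m ] -[1+ n ] = begin
    (suc m ℕ.* suc n) ×ₙ 1#                ≈⟨ ×1-homo-* (suc m) (suc n) ⟩
    suc m ×ₙ 1# * suc n ×ₙ 1#              ≈⟨ -‿involutive _ ⟨
    - - (suc m ×ₙ 1# * suc n ×ₙ 1#)        ≈⟨ -‿cong (-‿distribˡ-* _ _) ⟩
    - (- (suc m ×ₙ 1#) * suc n ×ₙ 1#)      ≈⟨ -‿distribʳ-* _ _ ⟩
    - (suc m ×ₙ 1#) * - (suc n ×ₙ 1#)      ∎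

  -‿homo : ∀ i → ⟦ ℤ.- i ⟧ᶻ ≈ - ⟦ i ⟧ᶻ
  -‿homo (+ zero)    = sym -0#≈0#
  -‿homo (+ (suc n)) = refl
  -‿homo -[1+ n ]    = sym (-‿involutive _)

  morphism : ℤ.+-*-rawRing -Raw-AlmostCommutative⟶ fromCommutativeRing R
  morphism = record
    { ⟦_⟧    = ⟦_⟧ᶻ
    ; +-homo = +-homo
    ; *-homo = *-homo
    ; -‿homo = -‿homo
    ; 0-homo = refl
    ; 1-homo = refl
    }

  -- Only a weak decision is possible: distinct integers may coincide in the ring, as they do in a
  -- quotient that turns out to be trivial.
  coefficient-equality : ∀ i j → Maybe (⟦ i ⟧ᶻ ≈ ⟦ j ⟧ᶻ)
  coefficient-equality i j = map (λ i≡j → reflexive (≡.cong ⟦_⟧ᶻ i≡j)) (dec⇒weaklyDec ℤ._≟_ i j)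

  open RingSolver ℤ.+-*-rawRing (fromCommutativeRing R) morphism coefficient-equality public
    using (solve; _:=_; _:+_; _:*_; _:-_; :-_; con)

-- Sums over initial segments

module RangeSum {c ℓ} (R : CommutativeRing c ℓ) where
  open CommutativeRing R
  open Sum semiring using (sum)
  open SetoidReasoning setoid

  -- Splitting off the last term suits the induction on the length of the generating function, and
  -- natural-number indices allow a sum to be cut at any row.
  Σ< : ℕ → (ℕ → Carrier) → Carrier
  Σ< zero    t = 0#
  Σ< (suc n) t = Σ< n t + t n

  Σ<-cong : ∀ n {s t} → (∀ m → m ℕ.< n → s m ≈ t m) → Σ< n s ≈ Σ< n t
  Σ<-cong zero    s≈t = refl
  Σ<-cong (suc n) s≈t = +-cong (Σ<-cong n λ m m<n → s≈t m (ℕ.m<n⇒m<1+n m<n)) (s≈t n (ℕ.n<1+n n))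

  Σ<-+ : ∀ m n t → Σ< (m ℕ.+ n) t ≈ Σ< m t + Σ< n (λ i → t (m ℕ.+ i))
  Σ<-+ m zero    t rewrite ℕ.+-identityʳ m = sym (+-identityʳ _)
  Σ<-+ m (suc n) t rewrite ℕ.+-suc m n = trans (+-congʳ (Σ<-+ m n t)) (+-assoc _ _ _)

  sum≈Σ< : ∀ n t → sum {n} (λ i → t (toℕ i)) ≈ Σ< n t
  sum≈Σ< zero    t = refl
  sum≈Σ< (suc n) t = begin
    t 0 + sum {n} (λ i → t (suc (toℕ i)))   ≈⟨ +-cong (sym (+-identityˡ _)) (sum≈Σ< n (λ i → t (suc i))) ⟩
    Σ< 1 t + Σ< n (λ i → t (suc i))         ≈⟨ Σ<-+ 1 n t ⟨
    Σ< (suc n) t                            ∎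

-- Quotient by a principal ideal

module PrincipalQuotient {c ℓ} (R : CommutativeRing c ℓ) (f : CommutativeRing.Carrier R) where
  open CommutativeRing R
  open IntegerCoefficients R
  open SetoidReasoning setoid

  infix 4 _≋_
  -- The cofactor is kept as data, so that a proof of `1# ≋ 0#` contains an inverse of `f`.
  _≋_ : Carrier → Carrier → Set (c ⊔ ℓ)
  a ≋ b = ∃[ q ] a ≈ b + f * q

  ≈⇒≋ : ∀ {a b} → a ≈ b → a ≋ b
  ≈⇒≋ {a} {b} a≈b = 0# , trans a≈b (sym (trans (+-congˡ (zeroʳ f)) (+-identityʳ b)))

  ≋-sym : ∀ {a b} → a ≋ b → b ≋ a
  ≋-sym {a} {b} (q , a≈b+fq) = - q , (begin
    b                  ≈⟨ solve 3 (λ b f q → b := b :+ f :* q :+ f :* (:- q)) refl b f q ⟩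
    b + f * q + f * - q ≈⟨ +-congʳ a≈b+fq ⟨
    a + f * - q        ∎)

  ≋-trans : ∀ {a b d} → a ≋ b → b ≋ d → a ≋ d
  ≋-trans {a} {b} {d} (q , a≈b+fq) (p , b≈d+fp) = p + q , (begin
    a                    ≈⟨ a≈b+fq ⟩
    b + f * q            ≈⟨ +-congʳ b≈d+fp ⟩
    d + f * p + f * q    ≈⟨ solve 4 (λ d f p q → d :+ f :* p :+ f :* q := d :+ f :* (p :+ q)) refl d f p q ⟩
    d + f * (p + q)      ∎)

  +-cong-≋ : ∀ {a a′ b b′} → a ≋ a′ → b ≋ b′ → a + b ≋ a′ + b′
  +-cong-≋ {a} {a′} {b} {b′} (q , a≈) (p , b≈) = q + p , (begin
    a + b                        ≈⟨ +-cong a≈ b≈ ⟩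
    (a′ + f * q) + (b′ + f * p)  ≈⟨ solve 5 (λ a b f q p → (a :+ f :* q) :+ (b :+ f :* p) := (a :+ b) :+ f :* (q :+ p)) refl a′ b′ f q p ⟩
    (a′ + b′) + f * (q + p)      ∎)

  *-cong-≋ : ∀ {a a′ b b′} → a ≋ a′ → b ≋ b′ → a * b ≋ a′ * b′
  *-cong-≋ {a} {a′} {b} {b′} (q , a≈) (p , b≈) = a′ * p + q * b′ + q * (f * p) , (begin
    a * b                        ≈⟨ *-cong a≈ b≈ ⟩
    (a′ + f * q) * (b′ + f * p)  ≈⟨ solve 5 (λ a b f q p → (a :+ f :* q) :* (b :+ f :* p) := a :* b :+ f :* (a :* p :+ q :* b :+ q :* (f :* p))) refl a′ b′ f q p ⟩
    a′ * b′ + f * (a′ * p + q * b′ + q * (f * p))      ∎)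

  -‿cong-≋ : ∀ {a a′} → a ≋ a′ → - a ≋ - a′
  -‿cong-≋ {a} {a′} (q , a≈) = - q , (begin
    - a            ≈⟨ -‿cong a≈ ⟩
    - (a′ + f * q) ≈⟨ solve 3 (λ a f q → :- (a :+ f :* q) := :- a :+ f :* (:- q)) refl a′ f q ⟩
    - a′ + f * - q ∎)

  f≋0 : f ≋ 0#
  f≋0 = 1# , sym (trans (+-identityˡ _) (*-identityʳ f))

  quotient : CommutativeRing c (c ⊔ ℓ)
  quotient = record
    { Carrier = Carrier
    ; _≈_ = _≋_
    ; _+_ = _+_
    ; _*_ = _*_
    ; -_ = -_
    ; 0# = 0#
    ; 1# = 1#
    ; isCommutativeRing = record
      { isRing = record
        { +-isAbelianGroup = record
          { isGroup = record
            { isMonoid = record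
              { isSemigroup = record
                { isMagma = record
                  { isEquivalence = record { refl = ≈⇒≋ refl ; sym = ≋-sym ; trans = ≋-trans }
                  ; ∙-cong = +-cong-≋
                  }
                ; assoc = λ a b d → ≈⇒≋ (+-assoc a b d)
                }
              ; identity = (λ a → ≈⇒≋ (+-identityˡ a)) , (λ a → ≈⇒≋ (+-identityʳ a))
              }
            ; inverse = (λ a → ≈⇒≋ (-‿inverseˡ a)) , (λ a → ≈⇒≋ (-‿inverseʳ a))
            ; ⁻¹-cong = -‿cong-≋
            }
          ; comm = λ a b → ≈⇒≋ (+-comm a b)
          }
        ; *-cong = *-cong-≋
        ; *-assoc = λ a b d → ≈⇒≋ (*-assoc a b d)
        ; *-identity = (λ a → ≈⇒≋ (*-identityˡ a)) , (λ a → ≈⇒≋ (*-identityʳ a))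
        ; distrib = (λ a b d → ≈⇒≋ (distribˡ a b d)) , (λ a b d → ≈⇒≋ (distribʳ a b d))
        }
      ; *-comm = λ a b → ≈⇒≋ (*-comm a b)
      }
    }

  projection-isRingHomomorphism : IsRingHomomorphism rawRing (CommutativeRing.rawRing quotient) id
  projection-isRingHomomorphism = record
    { isSemiringHomomorphism = record
      { isNearSemiringHomomorphism = record
        { +-isMonoidHomomorphism = record
          { isMagmaHomomorphism = record
            { isRelHomomorphism = record { cong = ≈⇒≋ }
            ; homo = λ _ _ → ≈⇒≋ refl
            }
          ; ε-homo = ≈⇒≋ refl
          }
        ; *-homo = λ _ _ → ≈⇒≋ refl
        }
      ; 1#-homo = ≈⇒≋ refl
      }
    ; -‿homo = λ _ → ≈⇒≋ refl
    }

  open Exp semiring using (_^_)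
  open Exp (CommutativeRing.semiring quotient) using () renaming (_^_ to _^≋_)
  open RangeSum R using (Σ<)
  open RangeSum quotient using () renaming (Σ< to Σ<≋)

  -- The operations are the same on both sides, but powers with a variable exponent do not unfold,
  -- so they have to be matched by induction.
  ^-quotient : ∀ a n → a ^≋ n ≡ a ^ n
  ^-quotient a zero    = ≡.refl
  ^-quotient a (suc n) = ≡.cong (a *_) (^-quotient a n)

  Σ<-quotient : ∀ n {s t} → (∀ m → s m ≡ t m) → Σ<≋ n s ≡ Σ< n t
  Σ<-quotient zero    s≡t = ≡.refl
  Σ<-quotient (suc n) s≡t = ≡.cong₂ _+_ (Σ<-quotient n s≡t) (s≡t n)

  trivial⇒invertible : 1# ≋ 0# → ∃[ g ] f * g ≈ 1#
  trivial⇒invertible (g , 1≈0+fg) = g , sym (trans 1≈0+fg (+-identityˡ _))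

-- Constructive order on the reals

module RealOrder {c ℓ₁ ℓ₂ ℓ₃} (R : RealNumbers c ℓ₁ ℓ₂ ℓ₃) where
  open RealNumbers R
  open CommutativeRing commutativeRing using (ring)
  open IsStrictPartialOrder <-isStrictPartialOrder
    using (<-respʳ-≈; <-respˡ-≈) renaming (irrefl to <-irrefl; trans to <-trans; asym to <-asym)
  open IntegerCoefficients commutativeRing using (solve; _:=_; _:+_; _:*_; _:-_; :-_; con)
  open SetoidReasoning setoid
  open Mult semiring using (×-homo-+)

  x<y⇒0<y-x : ∀ {x y} → x < y → 0# < y - x
  x<y⇒0<y-x {x} x<y = <-respˡ-≈ (-‿inverseʳ x) (+-monoˡ-< (- x) x<y)

  0<y-x⇒x<y : ∀ {x y} → 0# < y - x → x < y
  0<y-x⇒x<y {x} {y} 0<y-x =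
    <-respʳ-≈ (solve 2 (λ x y → (y :- x) :+ x := y) refl x y)
      (<-respˡ-≈ (+-identityˡ x) (+-monoˡ-< x 0<y-x))

  +-positive : ∀ {x y} → 0# < x → 0# < y → 0# < x + y
  +-positive {x} {y} 0<x 0<y = <-trans 0<y (<-respˡ-≈ (+-identityˡ y) (+-monoˡ-< y 0<x))

  x<0⇒0<-x : ∀ {x} → x < 0# → 0# < - x
  x<0⇒0<-x {x} x<0 = <-respʳ-≈ (+-identityˡ (- x)) (x<y⇒0<y-x x<0)

  0<-x⇒x<0 : ∀ {x} → 0# < - x → x < 0#
  0<-x⇒x<0 {x} 0<-x = 0<y-x⇒x<y (<-respʳ-≈ (sym (+-identityˡ (- x))) 0<-x)

  -x*-x≈x*x : ∀ x → - x * - x ≈ x * x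
  -x*-x≈x*x = solve 1 (λ x → :- x :* :- x := x :* x) refl

  #⇒square-positive : ∀ {x} → x # 0# → 0# < x * x
  #⇒square-positive {x} x#0 with #⇒<⊎> x#0
  ... | inj₁ x<0 = <-respʳ-≈ (-x*-x≈x*x x) (*-positive (x<0⇒0<-x x<0) (x<0⇒0<-x x<0))
  ... | inj₂ 0<x = *-positive 0<x 0<x

  -- Here and below `¬ (x < 0#)` plays the part of `0 ≤ x`. If the square were negative, `x` could
  -- not be apart from zero, so it would be zero by tightness.
  square-nonnegative : ∀ x → ¬ (x * x < 0#)
  square-nonnegative x xx<0 = <-irrefl (trans (*-congʳ x≈0) (zeroˡ x)) xx<0
    where
    x≈0 : x ≈ 0#
    x≈0 = proj₁ (tight x 0#) λ x#0 → <-asym xx<0 (#⇒square-positive x#0)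

  invertible⇒#0 : ∀ {x u} → u * x ≈ 1# → x # 0#
  invertible⇒#0 {x} {u} ux≈1 =
    invertible⇒# (u , trans (*-congˡ x-0≈x) ux≈1 , trans (*-congʳ x-0≈x) (trans (*-comm x u) ux≈1))
    where
    x-0≈x : x - 0# ≈ x
    x-0≈x = solve 1 (λ x → x :- con (+ 0) := x) refl x

  positive-square⇒#0 : ∀ {x} → 0# < x * x → x # 0#
  positive-square⇒#0 {x} 0<xx = invertible⇒#0 (trans (*-assoc _ x x) (⁻¹-inverseˡ (x * x) 0<xx))

  0<1 : 0# < 1#
  0<1 = <-respʳ-≈ (*-identityˡ 1#) (#⇒square-positive (invertible⇒#0 (*-identityˡ 1#)))

  ⁻¹-positive : ∀ {x} (0<x : 0# < x) → 0# < x ⁻¹[ 0<x ]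
  ⁻¹-positive {x} 0<x with #⇒<⊎> (invertible⇒#0 (trans (*-comm x (x ⁻¹[ 0<x ])) (⁻¹-inverseˡ x 0<x)))
  ... | inj₂ 0<u = 0<u
  ... | inj₁ u<0 = ⊥-elim (<-asym 0<1 (0<-x⇒x<0 (<-respʳ-≈ -ux≈-1 (*-positive (x<0⇒0<-x u<0) 0<x))))
    where
    -ux≈-1 : - (x ⁻¹[ 0<x ]) * x ≈ - 1#
    -ux≈-1 = trans (sym (RingProperties.-‿distribˡ-* ring _ x)) (-‿cong (⁻¹-inverseˡ x 0<x))

  *-cancelʳ-positive : ∀ {x y} → 0# < y → 0# < x * y → 0# < x
  *-cancelʳ-positive {x} {y} 0<y 0<xy = <-respʳ-≈ (begin
    x * y * y ⁻¹[ 0<y ]     ≈⟨ solve 3 (λ x y u → x :* y :* u := u :* y :* x) refl x y (y ⁻¹[ 0<y ]) ⟩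
    y ⁻¹[ 0<y ] * y * x     ≈⟨ *-congʳ (⁻¹-inverseˡ y 0<y) ⟩
    1# * x                  ≈⟨ *-identityˡ x ⟩
    x                       ∎) (*-positive 0<xy (⁻¹-positive 0<y))

  +-nonnegative-positive : ∀ {x y} → ¬ (x < 0#) → 0# < y → 0# < y + x
  +-nonnegative-positive {x} {y} x≮0 0<y with <-cotrans 0<y (y + x)
  ... | inj₁ 0<y+x = 0<y+x
  ... | inj₂ y+x<y = ⊥-elim (x≮0 (0<-x⇒x<0
    (<-respʳ-≈ (solve 2 (λ x y → y :- (y :+ x) := :- x) refl x y) (x<y⇒0<y-x y+x<y))))

  *-nonnegative-positive : ∀ {x y} → ¬ (x < 0#) → 0# < y → ¬ (x * y < 0#)
  *-nonnegative-positive {x} {y} x≮0 0<y xy<0 = x≮0 (0<-x⇒x<0 (*-cancelʳ-positive 0<y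
    (<-respʳ-≈ (RingProperties.-‿distribˡ-* ring x y) (x<0⇒0<-x xy<0))))

  square-*-nonnegative : ∀ x {y} → 0# < y → ¬ (x * x * y < 0#)
  square-*-nonnegative x = *-nonnegative-positive (square-nonnegative x)

  -- An invertible product makes `y` invertible, hence positive or negative, and a negative `y`
  -- would make the product nonpositive.
  square-*-positive⇒positive : ∀ x {y} → 0# < x * x * y → 0# < y
  square-*-positive⇒positive x {y} 0<xxy with #⇒<⊎> (invertible⇒#0 {u = u * (x * x)} uxx*y≈1)
    where
    u = (x * x * y) ⁻¹[ 0<xxy ]
    uxx*y≈1 : u * (x * x) * y ≈ 1#
    uxx*y≈1 = trans (*-assoc u (x * x) y) (⁻¹-inverseˡ _ 0<xxy)
  ... | inj₂ 0<y = 0<y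
  ... | inj₁ y<0 = ⊥-elim (square-*-nonnegative x (x<0⇒0<-x y<0) (0<-x⇒x<0 (<-respʳ-≈
    (solve 2 (λ x y → x :* x :* y := :- (x :* x :* (:- y))) refl x y) 0<xxy)))

  -- Factor the difference as `(y - x) * (y + x)`. Comparing `y - x` with `0# < y + y` either gives
  -- the claim or makes `y + x` positive and thus cancellable; the sign of `x` is never decided.
  square-cancel-< : ∀ {x y} → 0# < y → 0# < y * y - x * x → 0# < y - x
  square-cancel-< {x} {y} 0<y 0<yy-xx with <-cotrans (+-positive 0<y 0<y) (y - x)
  ... | inj₁ 0<y-x = 0<y-x
  ... | inj₂ y-x<2y = *-cancelʳ-positive 0<y+x
    (<-respʳ-≈ (solve 2 (λ x y → y :* y :- x :* x := (y :- x) :* (y :+ x)) refl x y) 0<yy-xx)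
    where
    0<y+x : 0# < y + x
    0<y+x = <-respʳ-≈ (solve 2 (λ x y → (y :+ y) :- (y :- x) := y :+ x) refl x y) (x<y⇒0<y-x y-x<2y)

  #⇒difference-square-positive : ∀ {x y} → x # y → 0# < (x - y) * (x - y)
  #⇒difference-square-positive {x} {y} x#y with #⇒<⊎> x#y
  ... | inj₁ x<y = <-respʳ-≈ (solve 2 (λ x y → (y :- x) :* (y :- x) := (x :- y) :* (x :- y)) refl x y)
                     (*-positive (x<y⇒0<y-x x<y) (x<y⇒0<y-x x<y))
  ... | inj₂ y<x = *-positive (x<y⇒0<y-x y<x) (x<y⇒0<y-x y<x)

  <-scaled : ∀ {s x y x′ y′} → 0# < s → x′ ≈ s * x → y′ ≈ s * y → x < y → x′ < y′
  <-scaled {s} {x} {y} {x′} {y′} 0<s x′≈sx y′≈sy x<y = 0<y-x⇒x<y (<-respʳ-≈ (begin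
    s * (y - x)      ≈⟨ solve 3 (λ s x y → s :* (y :- x) := s :* y :- s :* x) refl s x y ⟩
    s * y - s * x    ≈⟨ +-cong y′≈sy (-‿cong x′≈sx) ⟨
    y′ - x′          ∎) (*-positive 0<s (x<y⇒0<y-x x<y)))

  #-scaled : ∀ {s x y x′ y′} → 0# < s → x′ ≈ s * x → y′ ≈ s * y → x # y → x′ # y′
  #-scaled 0<s x′≈sx y′≈sy x#y =
    <⊎>⇒# (Sum⊎.map (<-scaled 0<s x′≈sx y′≈sy) (<-scaled 0<s y′≈sy x′≈sx) (#⇒<⊎> x#y))

  ^-positive : ∀ {x} → 0# < x → ∀ n → 0# < x ^ n
  ^-positive 0<x zero    = 0<1
  ^-positive 0<x (suc n) = *-positive 0<x (^-positive 0<x n)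

  fromℕ-positive : ∀ n → 0# < fromℕ (suc n)
  fromℕ-positive zero    = <-respʳ-≈ (sym (+-identityʳ 1#)) 0<1
  fromℕ-positive (suc n) = +-positive 0<1 (fromℕ-positive n)

  fromℕ-nonnegative : ∀ n → ¬ (fromℕ n < 0#)
  fromℕ-nonnegative zero    = <-irrefl refl
  fromℕ-nonnegative (suc n) = <-asym (fromℕ-positive n)

  fromℕ-+ : ∀ m n → fromℕ (m ℕ.+ n) ≈ fromℕ m + fromℕ n
  fromℕ-+ = ×-homo-+ 1#

-- Shift operators and circulant matrices

-- A model of R[E]/(E^n - r): operator expressions in the shift E, compared by their
-- action on the sequences with x (n + m) = r x m.  Such a sequence is determined by
-- its first n terms, on which Σ a_m E^m acts as the r-circulant matrix of a.
module ShiftOperators {c ℓ} (R : CommutativeRing c ℓ) (n : ℕ) .{{_ : ℕ.NonZero n}}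
                      (r : CommutativeRing.Carrier R) where
  open CommutativeRing R hiding (zero)
  open SquareMatrix R
  open Sum semiring
    using (sum; sum-cong-≋; sum-replicate-zero; *-distribʳ-sum)
  open Exp semiring using (_^_)
  open RingProperties ring using (-1*x≈-x)
  open IntegerCoefficients R
  open RangeSum R
  open SetoidReasoning setoid

  Sequence : Set c
  Sequence = ℕ → Carrier

  infix 4 _≐_
  _≐_ : Sequence → Sequence → Set ℓ
  x ≐ y = ∀ m → x m ≈ y m

  TwistedPeriodic : Sequence → Set ℓ
  TwistedPeriodic x = ∀ m → x (n ℕ.+ m) ≈ r * x m

  infixl 6 _⊕_
  infixl 7 _⊗_
  -- Syntax instead of arbitrary maps on sequences: linearity, shift invariance and commutativity
  -- can then be proved by induction.
  data Operator : Set c where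
    scalar  : Carrier → Operator
    E       : Operator
    _⊕_ _⊗_ : Operator → Operator → Operator

  apply : Operator → Sequence → Sequence
  apply (scalar s) x m = s * x m
  apply E          x m = x (suc m)
  apply (a ⊕ b)    x m = apply a x m + apply b x m
  apply (a ⊗ b)    x   = apply a (apply b x)

  apply-cong : ∀ a {x y} → x ≐ y → apply a x ≐ apply a y
  apply-cong (scalar s) x≐y m = *-congˡ (x≐y m)
  apply-cong E          x≐y m = x≐y (suc m)
  apply-cong (a ⊕ b)    x≐y m = +-cong (apply-cong a x≐y m) (apply-cong b x≐y m)
  apply-cong (a ⊗ b)    x≐y   = apply-cong a (apply-cong b x≐y)

  apply-+ : ∀ a x y → apply a (λ m → x m + y m) ≐ (λ m → apply a x m + apply a y m)
  apply-+ (scalar s) x y m = distribˡ s (x m) (y m)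
  apply-+ E          x y m = refl
  apply-+ (a ⊕ b)    x y m = trans (+-cong (apply-+ a x y m) (apply-+ b x y m))
    (solve 4 (λ p q s t → p :+ q :+ (s :+ t) := p :+ s :+ (q :+ t)) refl _ _ _ _)
  apply-+ (a ⊗ b)    x y m = trans (apply-cong a (apply-+ b x y) m) (apply-+ a _ _ m)

  apply-* : ∀ a s x → apply a (λ m → s * x m) ≐ (λ m → s * apply a x m)
  apply-* (scalar t) s x m = solve 3 (λ t s y → t :* (s :* y) := s :* (t :* y)) refl t s (x m)
  apply-* E          s x m = refl
  apply-* (a ⊕ b)    s x m = trans (+-cong (apply-* a s x m) (apply-* b s x m)) (sym (distribˡ s _ _))
  apply-* (a ⊗ b)    s x m = trans (apply-cong a (apply-* b s x) m) (apply-* a s _ m)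

  apply-shift : ∀ a k x → apply a (λ m → x (k ℕ.+ m)) ≐ (λ m → apply a x (k ℕ.+ m))
  apply-shift (scalar s) k x m = refl
  apply-shift E          k x m rewrite ℕ.+-suc k m = refl
  apply-shift (a ⊕ b)    k x m = +-cong (apply-shift a k x m) (apply-shift b k x m)
  apply-shift (a ⊗ b)    k x m = trans (apply-cong a (apply-shift b k x) m) (apply-shift a k _ m)

  -- Induction on `a` suffices: scalars commute with `b` by linearity, and `E` does because `b` is
  -- shift invariant.
  apply-comm : ∀ a b x → apply a (apply b x) ≐ apply b (apply a x)
  apply-comm (scalar s)  b x m = sym (apply-* b s x m)
  apply-comm E           b x m = sym (apply-shift b 1 x m)
  apply-comm (a₁ ⊕ a₂)   b x m =
    trans (+-cong (apply-comm a₁ b x m) (apply-comm a₂ b x m)) (sym (apply-+ b _ _ m))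
  apply-comm (a₁ ⊗ a₂)   b x m =
    trans (apply-cong a₁ (apply-comm a₂ b x) m) (apply-comm a₁ b _ m)

  apply-periodic : ∀ a {x} → TwistedPeriodic x → TwistedPeriodic (apply a x)
  apply-periodic a {x} periodic m = begin
    apply a x (n ℕ.+ m)               ≈⟨ apply-shift a n x m ⟨
    apply a (λ i → x (n ℕ.+ i)) m     ≈⟨ apply-cong a periodic m ⟩
    apply a (λ i → r * x i) m         ≈⟨ apply-* a r x m ⟩
    r * apply a x m                   ∎

  apply-zero : ∀ a → apply a (λ _ → 0#) ≐ (λ _ → 0#)
  apply-zero a m = begin
    apply a (λ _ → 0#) m              ≈⟨ apply-cong a (λ _ → sym (zeroˡ 0#)) m ⟩
    apply a (λ _ → 0# * 0#) m         ≈⟨ apply-* a 0# (λ _ → 0#) m ⟩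
    0# * apply a (λ _ → 0#) m         ≈⟨ zeroˡ _ ⟩
    0#                                ∎

  apply-sum : ∀ a {k} (x : Fin k → Sequence) →
              apply a (λ m → sum λ l → x l m) ≐ (λ m → sum λ l → apply a (x l) m)
  apply-sum a {zero}  x m = apply-zero a m
  apply-sum a {suc k} x m = trans (apply-+ a (x zero) _ m) (+-congˡ (apply-sum a (x ∘ suc) m))

  infix 4 _≗_
  -- On arbitrary sequences the relation `Eⁿ = r` would fail. Restricting the test sequences is
  -- compatible with products because operators preserve twisted periodicity.
  _≗_ : Operator → Operator → Set (c ⊔ ℓ)
  a ≗ b = ∀ x → TwistedPeriodic x → apply a x ≐ apply b x

  operatorRing : CommutativeRing c (c ⊔ ℓ)
  operatorRing = record
    { Carrier = Operator
    ; _≈_ = _≗_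
    ; _+_ = _⊕_
    ; _*_ = _⊗_
    ; -_ = scalar (- 1#) ⊗_
    ; 0# = scalar 0#
    ; 1# = scalar 1#
    ; isCommutativeRing = record
      { isRing = record
        { +-isAbelianGroup = record
          { isGroup = record
            { isMonoid = record
              { isSemigroup = record
                { isMagma = record
                  { isEquivalence = record
                    { refl  = λ _ _ _ → refl
                    ; sym   = λ a≗b x per m → sym (a≗b x per m)
                    ; trans = λ a≗b b≗d x per m → trans (a≗b x per m) (b≗d x per m)
                    }
                  ; ∙-cong = λ a≗a′ b≗b′ x per m → +-cong (a≗a′ x per m) (b≗b′ x per m)
                  }
                ; assoc = λ _ _ _ _ _ _ → +-assoc _ _ _
                }
              ; identity = (λ _ _ _ _ → trans (+-congʳ (zeroˡ _)) (+-identityˡ _))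
                         , (λ _ _ _ _ → trans (+-congˡ (zeroˡ _)) (+-identityʳ _))
              }
            ; inverse = (λ _ _ _ m → trans (+-congʳ (-1*x≈-x _)) (trans (-‿inverseˡ _) (sym (zeroˡ _))))
                      , (λ _ _ _ m → trans (+-congˡ (-1*x≈-x _)) (trans (-‿inverseʳ _) (sym (zeroˡ _))))
            ; ⁻¹-cong = λ a≗b x per m → *-congˡ (a≗b x per m)
            }
          ; comm = λ _ _ _ _ _ → +-comm _ _
          }
        ; *-cong = λ {a} {_} {_} {b′} a≗a′ b≗b′ x per m →
            trans (apply-cong a (b≗b′ x per) m) (a≗a′ _ (apply-periodic b′ per) m)
        ; *-assoc = λ _ _ _ _ _ _ → refl
        ; *-identity = (λ _ _ _ _ → *-identityˡ _)
                     , (λ a x _ m → trans (apply-* a 1# x m) (*-identityˡ _))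
        ; distrib = (λ a _ _ x _ m → apply-+ a _ _ m) , (λ _ _ _ _ _ _ → refl)
        }
      ; *-comm = λ a b x _ m → apply-comm a b x m
      }
    }

  open CommutativeRing operatorRing
    using () renaming (rawRing to operatorRawRing; semiring to operatorSemiring)
  open Exp operatorSemiring using () renaming (_^_ to _^ᴼ_)

  scalar-isRingHomomorphism : IsRingHomomorphism rawRing operatorRawRing scalar
  scalar-isRingHomomorphism = record
    { isSemiringHomomorphism = record
      { isNearSemiringHomomorphism = record
        { +-isMonoidHomomorphism = record
          { isMagmaHomomorphism = record
            { isRelHomomorphism = record { cong = λ s≈t _ _ _ → *-congʳ s≈t }
            ; homo = λ s t x _ m → distribʳ (x m) s t
            }
          ; ε-homo = λ _ _ _ → refl
          }
        ; *-homo = λ s t x _ m → *-assoc s t (x m)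
        }
      ; 1#-homo = λ _ _ _ → refl
      }
    ; -‿homo = λ s x _ m → begin
        - s * x m             ≈⟨ *-congʳ (-1*x≈-x s) ⟨
        (- 1# * s) * x m      ≈⟨ *-assoc (- 1#) s (x m) ⟩
        - 1# * (s * x m)      ∎
    }

  apply-E^ : ∀ k x → apply (E ^ᴼ k) x ≐ (λ m → x (k ℕ.+ m))
  apply-E^ zero    x m = *-identityˡ (x m)
  apply-E^ (suc k) x m = trans (apply-E^ k x (suc m)) (reflexive (≡.cong x (ℕ.+-suc k m)))

  E^n≗r : E ^ᴼ n ≗ scalar r
  E^n≗r x periodic m = trans (apply-E^ n x m) (periodic m)

  extend : (Fin n → Carrier) → Sequence
  extend v m = r ^ (m / n) * v (m mod n)

  extend-periodic : ∀ v → TwistedPeriodic (extend v)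
  extend-periodic v m = begin
    r ^ ((n ℕ.+ m) / n) * v ((n ℕ.+ m) mod n)   ≡⟨ ≡.cong₂ (λ q i → r ^ q * v i) quotient≡ remainder≡ ⟩
    r * r ^ (m / n) * v (m mod n)               ≈⟨ *-assoc r _ _ ⟩
    r * (r ^ (m / n) * v (m mod n))             ∎
    where
    quotient≡ : (n ℕ.+ m) / n ≡ suc (m / n)
    quotient≡ = ≡.trans (ℕ.+-distrib-/-∣ˡ m ∣-refl) (≡.cong (ℕ._+ m / n) (ℕ.n/n≡1 n))
    remainder≡ : (n ℕ.+ m) mod n ≡ m mod n
    remainder≡ = Fin.fromℕ<-cong _ _ (ℕ.%-remove-+ˡ m ∣-refl) _ _

  extend-unique : ∀ {y v} → TwistedPeriodic y → (∀ i → v i ≈ y (toℕ i)) → extend v ≐ y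
  extend-unique {y} {v} periodic v≈y m = begin
    r ^ (m / n) * v (m mod n)                ≈⟨ *-congˡ (v≈y (m mod n)) ⟩
    r ^ (m / n) * y (toℕ (m mod n))          ≡⟨ ≡.cong (λ k → r ^ (m / n) * y k) (Fin.toℕ-fromℕ< _) ⟩
    r ^ (m / n) * y (m % n)                  ≈⟨ iterate (m / n) (m % n) ⟩
    y ((m / n) ℕ.* n ℕ.+ m % n)              ≡⟨ ≡.cong y (≡.trans (ℕ.+-comm ((m / n) ℕ.* n) (m % n)) (≡.sym (ℕ.m≡m%n+[m/n]*n m n))) ⟩
    y m                                      ∎
    where
    iterate : ∀ q k → r ^ q * y k ≈ y (q ℕ.* n ℕ.+ k)
    iterate zero    k = *-identityˡ (y k)
    iterate (suc q) k = begin
      r * r ^ q * y k                        ≈⟨ *-assoc r _ _ ⟩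
      r * (r ^ q * y k)                      ≈⟨ *-congˡ (iterate q k) ⟩
      r * y (q ℕ.* n ℕ.+ k)                  ≈⟨ periodic _ ⟨
      y (n ℕ.+ (q ℕ.* n ℕ.+ k))              ≡⟨ ≡.cong y (ℕ.+-assoc n (q ℕ.* n) k) ⟨
      y (suc q ℕ.* n ℕ.+ k)                  ∎

  extend-toℕ : ∀ v i → extend v (toℕ i) ≈ v i
  extend-toℕ v i = begin
    r ^ (toℕ i / n) * v (toℕ i mod n)        ≡⟨ ≡.cong₂ (λ q j → r ^ q * v j) (ℕ.m<n⇒m/n≡0 (Fin.toℕ<n i)) mod≡ ⟩
    1# * v i                                 ≈⟨ *-identityˡ (v i) ⟩
    v i                                      ∎
    where
    mod≡ : toℕ i mod n ≡ i
    mod≡ = ≡.trans (Fin.fromℕ<-cong _ _ (ℕ.m<n⇒m%n≡m (Fin.toℕ<n i)) _ (Fin.toℕ<n i)) (Fin.fromℕ<-toℕ i _)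

  sum-*-1ᴹ : ∀ {k} (v : Fin k → Carrier) j → sum (λ l → v l * 1ᴹ l j) ≈ v j
  sum-*-1ᴹ {suc k} v zero = begin
    v zero * 1# + sum (λ l → v (suc l) * 0#)           ≈⟨ +-cong (*-identityʳ _) (sum-cong-≋ (λ l → zeroʳ (v (suc l)))) ⟩
    v zero + sum {k} (λ _ → 0#)                        ≈⟨ +-congˡ (sum-replicate-zero k) ⟩
    v zero + 0#                                        ≈⟨ +-identityʳ _ ⟩
    v zero                                             ∎
  sum-*-1ᴹ {suc k} v (suc j) = begin
    v zero * 0# + sum (λ l → v (suc l) * 1ᴹ (suc l) (suc j))  ≈⟨ +-cong (zeroʳ _) (sum-*-1ᴹ (v ∘ suc) j) ⟩
    0# + v (suc j)                                            ≈⟨ +-identityˡ _ ⟩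
    v (suc j)                                                 ∎

  basis : Fin n → Sequence
  basis j = extend (λ i → 1ᴹ i j)

  basis-periodic : ∀ j → TwistedPeriodic (basis j)
  basis-periodic j = extend-periodic (λ i → 1ᴹ i j)

  basis-toℕ : ∀ j i → basis j (toℕ i) ≈ 1ᴹ i j
  basis-toℕ j = extend-toℕ (λ i → 1ᴹ i j)

  1ᴹ-sym : ∀ {k} (i j : Fin k) → 1ᴹ i j ≈ 1ᴹ j i
  1ᴹ-sym zero    zero    = refl
  1ᴹ-sym zero    (suc j) = refl
  1ᴹ-sym (suc i) zero    = refl
  1ᴹ-sym (suc i) (suc j) = 1ᴹ-sym i j

  extend-basis : ∀ v → extend v ≐ (λ m → sum λ l → v l * basis l m)
  extend-basis v = extend-unique periodic agree
    where
    periodic : TwistedPeriodic (λ m → sum λ l → v l * basis l m)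
    periodic m = begin
      sum (λ l → v l * basis l (n ℕ.+ m))    ≈⟨ sum-cong-≋ (λ l → trans (*-congˡ (basis-periodic l m))
                                                  (solve 3 (λ v r b → v :* (r :* b) := v :* b :* r) refl (v l) r _)) ⟩
      sum (λ l → v l * basis l m * r)        ≈⟨ *-distribʳ-sum r (λ l → v l * basis l m) ⟨
      sum (λ l → v l * basis l m) * r        ≈⟨ *-comm _ r ⟩
      r * sum (λ l → v l * basis l m)        ∎
    agree : ∀ i → v i ≈ sum (λ l → v l * basis l (toℕ i))
    agree i = sym (begin
      sum (λ l → v l * basis l (toℕ i))      ≈⟨ sum-cong-≋ (λ l → *-congˡ (trans (basis-toℕ l i) (1ᴹ-sym i l))) ⟩
      sum (λ l → v l * 1ᴹ l i)               ≈⟨ sum-*-1ᴹ v i ⟩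
      v i                                    ∎)

  apply-extend : ∀ a v m → apply a (extend v) m ≈ sum (λ l → apply a (basis l) m * v l)
  apply-extend a v m = begin
    apply a (extend v) m                                ≈⟨ apply-cong a (extend-basis v) m ⟩
    apply a (λ k → sum λ l → v l * basis l k) m         ≈⟨ apply-sum a (λ l k → v l * basis l k) m ⟩
    sum (λ l → apply a (λ k → v l * basis l k) m)       ≈⟨ sum-cong-≋ (λ l → trans (apply-* a (v l) (basis l) m) (*-comm _ _)) ⟩
    sum (λ l → apply a (basis l) m * v l)               ∎

  matrix : Operator → Matrix n
  matrix a i j = apply a (basis j) (toℕ i)

  -- `apply b (basis j)` is twisted periodic, hence the extension of its first `n` terms, which form
  -- column `j` of `matrix b`; expanding it in the basis sequences yields the matrix product.
  matrix-⊗ : ∀ a b → matrix a *ᴹ matrix b ≈ᴹ matrix (a ⊗ b)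
  matrix-⊗ a b i j = begin
    sum (λ l → apply a (basis l) (toℕ i) * matrix b l j)  ≈⟨ apply-extend a (λ l → matrix b l j) (toℕ i) ⟨
    apply a (extend (λ l → matrix b l j)) (toℕ i)         ≈⟨ apply-cong a (extend-unique (apply-periodic b (basis-periodic j)) (λ _ → refl)) (toℕ i) ⟩
    apply a (apply b (basis j)) (toℕ i)                   ∎

  matrix-cong : ∀ a b → a ≗ b → matrix a ≈ᴹ matrix b
  matrix-cong _ _ a≗b i j = a≗b (basis j) (basis-periodic j) (toℕ i)

  matrix-1 : matrix (scalar 1#) ≈ᴹ 1ᴹ
  matrix-1 i j = trans (*-identityˡ _) (basis-toℕ j i)

  module _ (A : ℕ → Carrier) where

    open RangeSum operatorRing using () renaming (Σ< to Σ<ᴼ)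

    circulant : Operator
    circulant = Σ<ᴼ n (λ m → scalar (A m) ⊗ E ^ᴼ m)

    apply-circulant : ∀ x i → apply circulant x i ≈ Σ< n (λ m → A m * x (m ℕ.+ i))
    apply-circulant x i = go n
      where
      go : ∀ k → apply (Σ<ᴼ k (λ m → scalar (A m) ⊗ E ^ᴼ m)) x i ≈ Σ< k (λ m → A m * x (m ℕ.+ i))
      go zero    = zeroˡ _
      go (suc k) = +-cong (go k) (*-congˡ (apply-E^ k x i))

    -- `Circ` freed from its bound proofs, so that a row can be split at the diagonal.
    entry : ℕ → ℕ → Carrier
    entry i j with i ℕ.≤? j
    ... | yes _ = A (j ∸ i)
    ... | no _  = r * A (n ℕ.+ j ∸ i)

    Circ≈entry : ∀ (i j : Fin n) → Circ r (A ∘ toℕ) i j ≈ entry (toℕ i) (toℕ j)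
    Circ≈entry i j with toℕ i ℕ.≤? toℕ j
    ... | yes _ = reflexive (≡.cong A (Fin.toℕ-fromℕ< _))
    ... | no _  = *-congˡ (reflexive (≡.cong A (Fin.toℕ-fromℕ< _)))

    entry-upper : ∀ i m → entry i (i ℕ.+ m) ≡ A m
    entry-upper i m with i ℕ.≤? i ℕ.+ m
    ... | yes _    = ≡.cong A (ℕ.m+n∸m≡n i m)
    ... | no i≰i+m = contradiction (ℕ.m≤m+n i m) i≰i+m

    entry-lower : ∀ {i j} → j ℕ.< i → entry i j ≡ r * A (n ℕ.+ j ∸ i)
    entry-lower {i} {j} j<i with i ℕ.≤? j
    ... | yes i≤j = contradiction i≤j (ℕ.<⇒≱ j<i)
    ... | no _    = ≡.refl

    -- A column `j ≥ i` supplies the term `m = j - i`. A column `j < i` supplies `m = n + j - i`,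
    -- where periodicity absorbs the factor `r` by turning `x j` into `x (n + j)`. So the two blocks
    -- of the row are the two blocks of the other sum, swapped.
    Σ<-entry : ∀ {x} → TwistedPeriodic x → ∀ {i} → i ≤ n →
               Σ< n (λ j → entry i j * x j) ≈ Σ< n (λ m → A m * x (m ℕ.+ i))
    Σ<-entry {x} periodic {i} i≤n = begin
      Σ< n s                                        ≡⟨ ≡.cong (λ k → Σ< k s) i+e≡n ⟨
      Σ< (i ℕ.+ e) s                                ≈⟨ Σ<-+ i e s ⟩
      Σ< i s + Σ< e (λ m → s (i ℕ.+ m))             ≈⟨ +-comm _ _ ⟩
      Σ< e (λ m → s (i ℕ.+ m)) + Σ< i s             ≈⟨ +-cong (Σ<-cong e upper) (Σ<-cong i lower) ⟩
      Σ< e t + Σ< i (λ m → t (e ℕ.+ m))             ≈⟨ Σ<-+ e i t ⟨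
      Σ< (e ℕ.+ i) t                                ≡⟨ ≡.cong (λ k → Σ< k t) e+i≡n ⟩
      Σ< n t                                        ∎
      where
      e = n ∸ i
      i+e≡n : i ℕ.+ e ≡ n
      i+e≡n = ℕ.m+[n∸m]≡n i≤n
      e+i≡n : e ℕ.+ i ≡ n
      e+i≡n = ℕ.m∸n+n≡m i≤n
      s t : ℕ → Carrier
      s j = entry i j * x j
      t m = A m * x (m ℕ.+ i)
      upper : ∀ m → m ℕ.< e → s (i ℕ.+ m) ≈ t m
      upper m _ = *-cong (reflexive (entry-upper i m)) (reflexive (≡.cong x (ℕ.+-comm i m)))
      e+m+i≡n+m : ∀ m → e ℕ.+ m ℕ.+ i ≡ n ℕ.+ m
      e+m+i≡n+m m = ≡.trans (ℕ.+-assoc e m i) (≡.trans (≡.cong (e ℕ.+_) (ℕ.+-comm m i))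
        (≡.trans (≡.sym (ℕ.+-assoc e i m)) (≡.cong (ℕ._+ m) e+i≡n)))
      n+m∸i≡e+m : ∀ m → n ℕ.+ m ∸ i ≡ e ℕ.+ m
      n+m∸i≡e+m m = ≡.trans (≡.cong (_∸ i) (≡.sym (e+m+i≡n+m m))) (ℕ.m+n∸n≡m (e ℕ.+ m) i)
      lower : ∀ m → m ℕ.< i → s m ≈ t (e ℕ.+ m)
      lower m m<i = begin
        entry i m * x m                             ≡⟨ ≡.cong (_* x m) (entry-lower m<i) ⟩
        r * A (n ℕ.+ m ∸ i) * x m                   ≡⟨ ≡.cong (λ k → r * A k * x m) (n+m∸i≡e+m m) ⟩
        r * A (e ℕ.+ m) * x m                       ≈⟨ solve 3 (λ r a x → r :* a :* x := a :* (r :* x)) refl r _ _ ⟩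
        A (e ℕ.+ m) * (r * x m)                     ≈⟨ *-congˡ (periodic m) ⟨
        A (e ℕ.+ m) * x (n ℕ.+ m)                   ≡⟨ ≡.cong (λ k → A (e ℕ.+ m) * x k) (e+m+i≡n+m m) ⟨
        A (e ℕ.+ m) * x (e ℕ.+ m ℕ.+ i)             ∎

    matrix-circulant : matrix circulant ≈ᴹ Circ r (A ∘ toℕ)
    matrix-circulant i j = begin
      apply circulant (basis j) (toℕ i)                  ≈⟨ apply-circulant (basis j) (toℕ i) ⟩
      Σ< n (λ m → A m * basis j (m ℕ.+ toℕ i))           ≈⟨ Σ<-entry (basis-periodic j) (ℕ.<⇒≤ (Fin.toℕ<n i)) ⟨
      Σ< n (λ l → entry (toℕ i) l * basis j l)           ≈⟨ sum≈Σ< n _ ⟨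
      sum {n} (λ l → entry (toℕ i) (toℕ l) * basis j (toℕ l))
        ≈⟨ sum-cong-≋ (λ l → *-cong (sym (Circ≈entry i l)) (basis-toℕ j l)) ⟩
      sum (λ l → Circ r (A ∘ toℕ) i l * 1ᴹ l j)          ≈⟨ sum-*-1ᴹ (Circ r (A ∘ toℕ) i) j ⟩
      Circ r (A ∘ toℕ) i j                               ∎

    Circ-invertible : ∀ g → circulant ⊗ g ≗ scalar 1# → IsInvertible (Circ {n} r (A ∘ toℕ))
    Circ-invertible g fg≗1 = matrix g , left , right
      where
      *ᴹ-cong : ∀ {X X′ Y Y′ : Matrix n} → X ≈ᴹ X′ → Y ≈ᴹ Y′ → X *ᴹ Y ≈ᴹ X′ *ᴹ Y′
      *ᴹ-cong X≈ Y≈ i j = sum-cong-≋ λ l → *-cong (X≈ i l) (Y≈ l j)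
      left : matrix g *ᴹ Circ r (A ∘ toℕ) ≈ᴹ 1ᴹ
      left i j = begin
        (matrix g *ᴹ Circ r (A ∘ toℕ)) i j      ≈⟨ *ᴹ-cong {X = matrix g} (λ _ _ → refl) matrix-circulant i j ⟨
        (matrix g *ᴹ matrix circulant) i j      ≈⟨ matrix-⊗ g circulant i j ⟩
        -- Commutativity turns the one-sided inverse into a two-sided one.
        matrix (g ⊗ circulant) i j              ≈⟨ apply-comm g circulant (basis j) (toℕ i) ⟩
        matrix (circulant ⊗ g) i j              ≈⟨ matrix-cong (circulant ⊗ g) (scalar 1#) fg≗1 i j ⟩
        matrix (scalar 1#) i j                  ≈⟨ matrix-1 i j ⟩
        1ᴹ i j                                  ∎
      right : Circ r (A ∘ toℕ) *ᴹ matrix g ≈ᴹ 1ᴹ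
      right i j = begin
        (Circ r (A ∘ toℕ) *ᴹ matrix g) i j      ≈⟨ *ᴹ-cong {Y = matrix g} matrix-circulant (λ _ _ → refl) i j ⟨
        (matrix circulant *ᴹ matrix g) i j      ≈⟨ matrix-⊗ circulant g i j ⟩
        matrix (circulant ⊗ g) i j              ≈⟨ matrix-cong (circulant ⊗ g) (scalar 1#) fg≗1 i j ⟩
        matrix (scalar 1#) i j                  ≈⟨ matrix-1 i j ⟩
        1ᴹ i j                                  ∎

-- Real algebras with an adjoined square root

module RealAlgebra {c ℓ₁ ℓ₂ ℓ₃ b ℓ} (R : RealNumbers c ℓ₁ ℓ₂ ℓ₃) (B : CommutativeRing b ℓ)
  (ι : RealNumbers.ℝ R → CommutativeRing.Carrier B)
  (ι-isHomomorphism : IsRingHomomorphism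
    (CommutativeRing.rawRing (RealNumbers.commutativeRing R)) (CommutativeRing.rawRing B) ι)
  where
  open RealNumbers R using (ℝ; _<_; *-positive; <-isStrictPartialOrder; _⁻¹[_]; ⁻¹-inverseˡ)
  module ℝ = CommutativeRing (RealNumbers.commutativeRing R)
  module ℝ^ = Exp ℝ.semiring
  module ℝᶻ = IntegerCoefficients (RealNumbers.commutativeRing R)
  open ℝ using () renaming (_+_ to _+ᴿ_; _*_ to _*ᴿ_; _-_ to _-ᴿ_; -_ to -ᴿ_; _≈_ to _≈ᴿ_; 0# to 0ᴿ; 1# to 1ᴿ)
  open ℝ^ using () renaming (_^_ to _^ᴿ_)
  open IsStrictPartialOrder <-isStrictPartialOrder using (<-respʳ-≈)
  open RealOrder R
  open CommutativeRing B
  open Exp semiring using (_^_)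
  module Bᶻ = IntegerCoefficients B
  open SetoidReasoning setoid
  open IsRingHomomorphism ι-isHomomorphism public
    using () renaming (⟦⟧-cong to ι-cong; +-homo to ι-+; *-homo to ι-*; 0#-homo to ι-0; 1#-homo to ι-1; -‿homo to ι-neg)

  ι-sub : ∀ x y → ι (x -ᴿ y) ≈ ι x - ι y
  ι-sub x y = trans (ι-+ x (-ᴿ y)) (+-congˡ (ι-neg y))

  ι-^ : ∀ x n → ι (x ^ᴿ n) ≈ ι x ^ n
  ι-^ x zero    = ι-1
  ι-^ x (suc n) = trans (ι-* x _) (*-congˡ (ι-^ x n))

  ι-positive⇒trivial : ∀ {x} → 0ᴿ < x → ι x ≈ 0# → 1# ≈ 0#
  ι-positive⇒trivial {x} 0<x ιx≈0 = begin
    1#                        ≈⟨ ι-1 ⟨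
    ι 1ᴿ                      ≈⟨ ι-cong (⁻¹-inverseˡ x 0<x) ⟨
    ι (x ⁻¹[ 0<x ] *ᴿ x)      ≈⟨ ι-* _ x ⟩
    ι (x ⁻¹[ 0<x ]) * ι x     ≈⟨ *-congˡ ιx≈0 ⟩
    ι (x ⁻¹[ 0<x ]) * 0#      ≈⟨ zeroʳ _ ⟩
    0#                        ∎

  module AdjoinedRoot (d : ℝ) (ε : Carrier) (ε²≈d : ε * ε ≈ ι d) where

    norm : ℝ → ℝ → ℝ
    norm t y = t *ᴿ t -ᴿ d *ᴿ (y *ᴿ y)

    element : ℝ → ℝ → Carrier
    element t y = ι t + ι y * ε

    element-cong : ∀ {t t′ y y′} → t ≈ᴿ t′ → y ≈ᴿ y′ → element t y ≈ element t′ y′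
    element-cong t≈ y≈ = +-cong (ι-cong t≈) (*-congʳ (ι-cong y≈))

    element-* : ∀ t y t′ y′ →
      element t y * element t′ y′ ≈ element (t *ᴿ t′ +ᴿ d *ᴿ (y *ᴿ y′)) (t *ᴿ y′ +ᴿ y *ᴿ t′)
    element-* t y t′ y′ = begin
      (ι t + ι y * ε) * (ι t′ + ι y′ * ε)
        ≈⟨ Bᶻ.solve 5 (λ t y u v e → let open Bᶻ in (t :+ y :* e) :* (u :+ v :* e) := t :* u :+ (e :* e) :* (y :* v) :+ (t :* v :+ y :* u) :* e) refl (ι t) (ι y) (ι t′) (ι y′) ε ⟩
      ι t * ι t′ + (ε * ε) * (ι y * ι y′) + (ι t * ι y′ + ι y * ι t′) * ε
        ≈⟨ +-cong (+-congˡ (*-cong ε²≈d (sym (ι-* y y′)))) (*-congʳ (+-cong (sym (ι-* t y′)) (sym (ι-* y t′)))) ⟩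
      ι t * ι t′ + ι d * ι (y *ᴿ y′) + (ι (t *ᴿ y′) + ι (y *ᴿ t′)) * ε
        ≈⟨ +-cong (+-cong (sym (ι-* t t′)) (sym (ι-* d _))) (*-congʳ (sym (ι-+ _ _))) ⟩
      ι (t *ᴿ t′) + ι (d *ᴿ (y *ᴿ y′)) + ι (t *ᴿ y′ +ᴿ y *ᴿ t′) * ε
        ≈⟨ +-congʳ (sym (ι-+ _ _)) ⟩
      element (t *ᴿ t′ +ᴿ d *ᴿ (y *ᴿ y′)) (t *ᴿ y′ +ᴿ y *ᴿ t′) ∎

    element-+ : ∀ t y t′ y′ → element t y + element t′ y′ ≈ element (t +ᴿ t′) (y +ᴿ y′)
    element-+ t y t′ y′ = begin
      (ι t + ι y * ε) + (ι t′ + ι y′ * ε)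
        ≈⟨ Bᶻ.solve 5 (λ t y u v e → let open Bᶻ in (t :+ y :* e) :+ (u :+ v :* e) := (t :+ u) :+ (y :+ v) :* e) refl (ι t) (ι y) (ι t′) (ι y′) ε ⟩
      (ι t + ι t′) + (ι y + ι y′) * ε
        ≈⟨ +-cong (sym (ι-+ t t′)) (*-congʳ (sym (ι-+ y y′))) ⟩
      element (t +ᴿ t′) (y +ᴿ y′) ∎

    element-0 : ∀ t → element t 0ᴿ ≈ ι t
    element-0 t = trans (+-congˡ (trans (*-congʳ ι-0) (zeroˡ ε))) (+-identityʳ _)

    -- Multiplying by the conjugate `t - y ε` produces a positive real that vanishes in `B`.
    norm-positive⇒trivial : ∀ {t y} → 0ᴿ < norm t y → element t y ≈ 0# → 1# ≈ 0#
    norm-positive⇒trivial {t} {y} 0<norm t+yε≈0 = ι-positive⇒trivial 0<norm (begin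
      ι (norm t y)
        ≈⟨ ι-cong (ℝᶻ.solve 3 (λ t d y → let open ℝᶻ in t :* t :- d :* (y :* y) :=
                     t :* t :+ d :* (y :* (:- y))) ℝ.refl t d y) ⟩
      ι (t *ᴿ t +ᴿ d *ᴿ (y *ᴿ (-ᴿ y)))
        ≈⟨ element-0 _ ⟨
      element (t *ᴿ t +ᴿ d *ᴿ (y *ᴿ (-ᴿ y))) 0ᴿ
        ≈⟨ element-cong ℝ.refl (ℝᶻ.solve 2 (λ t y → let open ℝᶻ in con (+ 0) := t :* (:- y) :+ y :* t) ℝ.refl t y) ⟩
      element (t *ᴿ t +ᴿ d *ᴿ (y *ᴿ (-ᴿ y))) (t *ᴿ (-ᴿ y) +ᴿ y *ᴿ t)
        ≈⟨ element-* t y t (-ᴿ y) ⟨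
      element t y * element t (-ᴿ y)
        ≈⟨ *-congʳ t+yε≈0 ⟩
      0# * element t (-ᴿ y)
        ≈⟨ zeroˡ _ ⟩
      0# ∎)

    -- Brahmagupta's identity.
    norm-* : ∀ t y t′ y′ →
      norm (t *ᴿ t′ +ᴿ d *ᴿ (y *ᴿ y′)) (t *ᴿ y′ +ᴿ y *ᴿ t′) ≈ᴿ norm t y *ᴿ norm t′ y′
    norm-* = ℝᶻ.solve 5 (λ d t y u v → let open ℝᶻ in
      (t :* u :+ d :* (y :* v)) :* (t :* u :+ d :* (y :* v)) :- d :* ((t :* v :+ y :* u) :* (t :* v :+ y :* u))
        := (t :* t :- d :* (y :* y)) :* (u :* u :- d :* (v :* v))) ℝ.refl d

    norm-1 : norm 1ᴿ 0ᴿ ≈ᴿ 1ᴿ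
    norm-1 = ℝᶻ.solve 1 (λ d → let open ℝᶻ in con (+ 1) :* con (+ 1) :- d :* (con (+ 0) :* con (+ 0)) := con (+ 1)) ℝ.refl d

    -- Coordinates in `B` need not be unique, so the norm cannot be recovered from the element and
    -- is carried along with them.
    element-^ : ∀ t y n → ∃[ t′ ] ∃[ y′ ] element t y ^ n ≈ element t′ y′ × norm t′ y′ ≈ᴿ (norm t y) ^ᴿ n
    element-^ t y zero    = 1ᴿ , 0ᴿ , sym (trans (element-0 1ᴿ) ι-1) , norm-1
    element-^ t y (suc n) with element-^ t y n
    ... | t′ , y′ , elementⁿ≈ , normⁿ≈ =
      _ , _ , trans (*-congˡ elementⁿ≈) (element-* t y t′ y′) ,
      ℝ.trans (norm-* t y t′ y′) (ℝ.*-congˡ normⁿ≈)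

    -- For d > 0 these are the elements that both embeddings ε ↦ ± √d make positive.
    TotallyPositive : Carrier → Set (c ⊔ ℓ₃ ⊔ ℓ)
    TotallyPositive x = ∃[ t ] ∃[ y ] x ≈ element t y × 0ᴿ < t × 0ᴿ < norm t y

    TP-resp-≈ : ∀ {x y} → x ≈ y → TotallyPositive x → TotallyPositive y
    TP-resp-≈ x≈y (t , y , x≈ , pos) = t , y , trans (sym x≈y) x≈ , pos

    TP-ι : ∀ {x} → 0ᴿ < x → TotallyPositive (ι x)
    TP-ι {x} 0<x = x , 0ᴿ , sym (element-0 x) , 0<x ,
      <-respʳ-≈ (ℝᶻ.solve 2 (λ x d → let open ℝᶻ in x :* x := x :* x :- d :* (con (+ 0) :* con (+ 0))) ℝ.refl x d)
        (*-positive 0<x 0<x)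

    -- Total positivity of zero is no contradiction by itself, since coordinates are not unique; it
    -- is how all sign arguments in `B` end.
    TP-0⇒trivial : TotallyPositive 0# → 1# ≈ 0#
    TP-0⇒trivial (t , y , 0≈ , _ , 0<norm) = norm-positive⇒trivial 0<norm (sym 0≈)

    module _ (0<d : 0ᴿ < d) where

      -- With `N`, `N′` the norms, `(t t′)² - (d y y′)² = N N′ + d y′² N + d y²
      -- N′`. Prescribing only the square of `x` covers both signs of `d y y′`: the negative one
      -- serves products, the positive one sums.
      cross-term : ∀ {t y t′ y′ x} → 0ᴿ < t → 0ᴿ < norm t y → 0ᴿ < t′ → 0ᴿ < norm t′ y′ →
        x *ᴿ x ≈ᴿ (d *ᴿ (y *ᴿ y′)) *ᴿ (d *ᴿ (y *ᴿ y′)) → 0ᴿ < t *ᴿ t′ -ᴿ x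
      cross-term {t} {y} {t′} {y′} {x} 0<t 0<N 0<t′ 0<N′ xx≈ = square-cancel-< (*-positive 0<t 0<t′)
        (<-respʳ-≈ (ℝ.trans rearrange (ℝ.+-congˡ (ℝ.-‿cong (ℝ.sym xx≈))))
          (+-nonnegative-positive (square-*-nonnegative y (*-positive 0<d 0<N′))
            (+-nonnegative-positive (square-*-nonnegative y′ (*-positive 0<d 0<N))
              (*-positive 0<N 0<N′))))
        where
        rearrange : norm t y *ᴿ norm t′ y′ +ᴿ y′ *ᴿ y′ *ᴿ (d *ᴿ norm t y) +ᴿ y *ᴿ y *ᴿ (d *ᴿ norm t′ y′)
                  ≈ᴿ (t *ᴿ t′) *ᴿ (t *ᴿ t′) -ᴿ (d *ᴿ (y *ᴿ y′)) *ᴿ (d *ᴿ (y *ᴿ y′))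
        rearrange = ℝᶻ.solve 5 (λ d t y u v → let open ℝᶻ in
          (t :* t :- d :* (y :* y)) :* (u :* u :- d :* (v :* v)) :+ v :* v :* (d :* (t :* t :- d :* (y :* y)))
              :+ y :* y :* (d :* (u :* u :- d :* (v :* v)))
            := (t :* u) :* (t :* u) :- (d :* (y :* v)) :* (d :* (y :* v))) ℝ.refl d t y t′ y′

      TP-* : ∀ {x x′} → TotallyPositive x → TotallyPositive x′ → TotallyPositive (x * x′)
      TP-* (t , y , x≈ , 0<t , 0<N) (t′ , y′ , x′≈ , 0<t′ , 0<N′) =
        _ , _ , trans (*-cong x≈ x′≈) (element-* t y t′ y′) ,
        <-respʳ-≈ (ℝᶻ.solve 2 (λ p q → let open ℝᶻ in p :- :- q := p :+ q) ℝ.refl (t *ᴿ t′) (d *ᴿ (y *ᴿ y′)))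
          (cross-term 0<t 0<N 0<t′ 0<N′ (-x*-x≈x*x _)) ,
        <-respʳ-≈ (ℝ.sym (norm-* t y t′ y′)) (*-positive 0<N 0<N′)

      TP-+ : ∀ {x x′} → TotallyPositive x → TotallyPositive x′ → TotallyPositive (x + x′)
      TP-+ (t , y , x≈ , 0<t , 0<N) (t′ , y′ , x′≈ , 0<t′ , 0<N′) =
        _ , _ , trans (+-cong x≈ x′≈) (element-+ t y t′ y′) , +-positive 0<t 0<t′ ,
        <-respʳ-≈ (ℝᶻ.solve 5 (λ d t y u v → let open ℝᶻ in
            (t :* t :- d :* (y :* y)) :+ (u :* u :- d :* (v :* v))
              :+ ((t :* u :- d :* (y :* v)) :+ (t :* u :- d :* (y :* v)))
            := (t :+ u) :* (t :+ u) :- d :* ((y :+ v) :* (y :+ v))) ℝ.refl d t y t′ y′)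
          (+-positive (+-positive 0<N 0<N′) (+-positive 0<cross 0<cross))
        where
        0<cross = cross-term 0<t 0<N 0<t′ 0<N′ ℝ.refl

      TP-^ : ∀ {x} → TotallyPositive x → ∀ n → TotallyPositive (x ^ n)
      TP-^ x>0 zero    = TP-resp-≈ ι-1 (TP-ι 0<1)
      TP-^ x>0 (suc n) = TP-* x>0 (TP-^ x>0 n)

-- Growth of the Pell-Tribonacci numbers

module PGrowth (k : ℕ) (1≤k : 1 ≤ k) where
  open ℕ.≤-Reasoning

  X<2kX : ∀ {X} → 0 ℕ.< X → X ℕ.< 2 ℕ.* k ℕ.* X
  X<2kX {X} 0<X = begin-strict
    X                 <⟨ ℕ.m<m+n X 0<X ⟩
    X ℕ.+ X           ≡⟨ ≡.cong (X ℕ.+_) (ℕ.+-identityʳ X) ⟨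
    2 ℕ.* X           ≤⟨ ℕ.*-monoˡ-≤ X (ℕ.*-monoʳ-≤ 2 1≤k) ⟩
    2 ℕ.* k ℕ.* X     ∎

  P-positive : ∀ m → 0 ℕ.< P k (suc m)
  P-increasing : ∀ m → P k (suc m) ℕ.< P k (suc (suc m))

  P-positive zero    = s≤s z≤n
  P-positive (suc m) = ℕ.<-trans (P-positive m) (P-increasing m)

  P-increasing zero    = ℕ.*-monoʳ-≤ 2 1≤k
  P-increasing (suc m) = ℕ.<-≤-trans (X<2kX (P-positive (suc m)))
    (ℕ.≤-trans (ℕ.m≤m+n _ (k ℕ.* P k (suc m))) (ℕ.m≤m+n _ (P k m)))

  -- Needed for `q(-1) > 0`, because `q(-1)` is 1 plus `r` times the difference of the two sides.
  -- The case `m = 0` is separate since `P k 2` is an initial value.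
  P-tail : ∀ m → k ℕ.* P k (suc m) ℕ.+ P k m ≤ P k (suc m) ℕ.+ P k (suc (suc m))
  P-tail zero = begin
    k ℕ.* 1 ℕ.+ 0         ≡⟨ ≡.trans (ℕ.+-identityʳ _) (ℕ.*-identityʳ k) ⟩
    k                     ≤⟨ ℕ.m≤m+n k _ ⟩
    2 ℕ.* k               ≤⟨ ℕ.n≤1+n _ ⟩
    suc (2 ℕ.* k)         ∎
  P-tail (suc m) = begin
    k ℕ.* X ℕ.+ Y                               ≤⟨ ℕ.+-mono-≤ (ℕ.*-monoˡ-≤ X (ℕ.m≤n*m k 2)) (ℕ.m≤n*m Y k {{ℕ.>-nonZero 1≤k}}) ⟩
    2 ℕ.* k ℕ.* X ℕ.+ k ℕ.* Y                   ≤⟨ ℕ.m≤m+n _ (P k m) ⟩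
    P k (suc (suc (suc m)))                     ≤⟨ ℕ.m≤n+m _ X ⟩
    X ℕ.+ P k (suc (suc (suc m)))               ∎
    where
    X = P k (suc (suc m))
    Y = P k (suc m)

-- The quadratic equation and the dichotomy

module Discriminant {c ℓ₁ ℓ₂ ℓ₃} (R : RealNumbers c ℓ₁ ℓ₂ ℓ₃) (k : ℕ) (1≤k : 1 ≤ k) (m : ℕ)
  (r : RealNumbers.ℝ R) (0<r : RealNumbers._<_ R (RealNumbers.0# R) r) where
  open RealNumbers R
  open IsStrictPartialOrder <-isStrictPartialOrder
    using (<-respʳ-≈; <-respˡ-≈)
  open IntegerCoefficients commutativeRing
  open RealOrder R
  open PGrowth k 1≤k
  open SetoidReasoning setoid
  open Mult semiring using (×1-homo-*)

  -- The matrix has size `n = m + 2`, so the indices are `n - 2`, `n - 1` and `n`.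
  p₀ p₁ p₂ : ℝ
  p₀ = fromℕ (P k m)
  p₁ = fromℕ (P k (suc m))
  p₂ = fromℕ (P k (suc (suc m)))

  -- Coefficients of the quadratic q = r p₁ z² - β z + r p₂ and its discriminant δ:
  -- (λ₁ z - β)² - δ = 2 λ₁ q.
  β λ₁ λ₂ δ : ℝ
  β  = 1# - r * (fromℕ k * p₁ + p₀)
  λ₁ = (r + r) * p₁
  λ₂ = (r + r) * p₂
  δ  = β * β - λ₁ * λ₂

  fromℕ-P-positive : ∀ m → 0# < fromℕ (P k (suc m))
  fromℕ-P-positive m with P k (suc m) | P-positive m
  ... | suc t | _ = fromℕ-positive t

  fromℕ-mono-< : ∀ {i j} → i ℕ.< j → 0# < fromℕ j - fromℕ i
  fromℕ-mono-< {i} {j} i<j with ℕ.m≤n⇒∃[o]m+o≡n i<j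
  ... | o , ≡.refl = <-respʳ-≈ (begin
    fromℕ (suc o)                          ≈⟨ solve 2 (λ x y → x := (y :+ x) :- y) refl (fromℕ (suc o)) (fromℕ i) ⟩
    fromℕ i + fromℕ (suc o) - fromℕ i      ≈⟨ +-congʳ (fromℕ-+ i (suc o)) ⟨
    fromℕ (i ℕ.+ suc o) - fromℕ i          ≡⟨ ≡.cong (λ l → fromℕ l - fromℕ i) (ℕ.+-suc i o) ⟩
    fromℕ (suc i ℕ.+ o) - fromℕ i          ∎) (fromℕ-positive o)

  fromℕ-mono-≤ : ∀ {i j} → i ≤ j → ¬ (fromℕ j - fromℕ i < 0#)
  fromℕ-mono-≤ {i} i≤j with ℕ.m≤n⇒∃[o]m+o≡n i≤j
  ... | o , ≡.refl = λ j-i<0 → fromℕ-nonnegative o (<-respˡ-≈ (trans (+-congʳ (fromℕ-+ i o))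
    (solve 2 (λ x y → x :+ y :- x := y) refl (fromℕ i) (fromℕ o))) j-i<0)

  0<p₁ : 0# < p₁
  0<p₁ = fromℕ-P-positive m

  0<p₂ : 0# < p₂
  0<p₂ = fromℕ-P-positive (suc m)

  0<λ₁ : 0# < λ₁
  0<λ₁ = *-positive (+-positive 0<r 0<r) 0<p₁

  0<λ₂ : 0# < λ₂
  0<λ₂ = *-positive (+-positive 0<r 0<r) 0<p₂

  module _ (0<δ : 0# < δ) where

    -- `β² = δ + λ₁ λ₂` is positive; this licenses the case split on the sign of `β`.
    β#0 : β # 0#
    β#0 = positive-square⇒#0 (<-respʳ-≈ (solve 2 (λ s t → (s :- t) :+ t := s) refl (β * β) (λ₁ * λ₂))
      (+-positive 0<δ (*-positive 0<λ₁ 0<λ₂)))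

    -- `β² > λ₁ λ₂ > λ₁²`, the latter because `P` increases. Thus the midpoint `β / λ₁` of the roots
    -- lies to the left of -1.
    λ₁<-β : β < 0# → 0# < - β - λ₁
    λ₁<-β β<0 = square-cancel-< (x<0⇒0<-x β<0) (<-respʳ-≈
      (solve 4 (λ β r p q → (β :* β :- (r :+ r) :* p :* ((r :+ r) :* q)) :+ (r :+ r) :* p :* (r :+ r) :* (q :- p)
         := :- β :* :- β :- (r :+ r) :* p :* ((r :+ r) :* p)) refl β r p₁ p₂)
      (+-positive 0<δ (*-positive (*-positive 0<λ₁ (+-positive 0<r 0<r)) (fromℕ-mono-< (P-increasing m)))))

    -- The difference is 2 λ₁ q(-1).
    δ<[β+λ₁]² : 0# < (- β - λ₁) * (- β - λ₁) - δ
    δ<[β+λ₁]² = <-respʳ-≈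
      (solve 5 (λ e r p q c → let β = e :- r :* c in ((r :+ r) :* p :+ (r :+ r) :* p) :* (e :+ r :* ((p :+ q) :- c)) := (:- β :- (r :+ r) :* p) :* (:- β :- (r :+ r) :* p) :- (β :* β :- (r :+ r) :* p :* ((r :+ r) :* q))) refl 1# r p₁ p₂ (fromℕ k * p₁ + p₀))
      (*-positive (+-positive 0<λ₁ 0<λ₁) (+-nonnegative-positive nonnegative 0<1))
      where
      nonnegative : ¬ (r * ((p₁ + p₂) - (fromℕ k * p₁ + p₀)) < 0#)
      nonnegative r*x<0 = *-nonnegative-positive (fromℕ-mono-≤ (P-tail m)) 0<r (<-respˡ-≈ (begin
        r * ((p₁ + p₂) - (fromℕ k * p₁ + p₀))  ≈⟨ *-comm r _ ⟩
        ((p₁ + p₂) - (fromℕ k * p₁ + p₀)) * r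
          ≈⟨ *-congʳ (+-cong (fromℕ-+ (P k (suc m)) _) (-‿cong (trans (fromℕ-+ (k ℕ.* P k (suc m)) (P k m)) (+-congʳ (×1-homo-* k (P k (suc m))))))) ⟨
        (fromℕ (P k (suc m) ℕ.+ P k (suc (suc m))) - fromℕ (k ℕ.* P k (suc m) ℕ.+ P k m)) * r ∎) r*x<0)

  module Dichotomy (T Y R′ W : ℝ) (0<R′ : 0# < R′) (0<W : 0# < W) (R′#W : R′ # W)
                   (norm≈W² : T * T - δ * (Y * Y) ≈ W * W) where

    D : ℝ
    D = (R′ * R′ - W * W) * (R′ * R′ - W * W)

    -- Here the hypothesis on `r` enters: `R′ - W` is apart from zero, and `R′ + W` is positive
    -- anyway.
    0<D : 0# < D
    0<D = <-respʳ-≈ (solve 2 (λ x y → (x :- y) :* (x :- y) :* ((x :+ y) :* (x :+ y)) := (x :* x :- y :* y) :* (x :* x :- y :* y)) refl R′ W)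
      (*-positive (#⇒difference-square-positive R′#W) (*-positive (+-positive 0<R′ 0<W) (+-positive 0<R′ 0<W)))

    s : ℝ
    s = (R′ + R′) * Y

    -- With T² = W² + δ Y², positivity of (W² + R′²)² - (2 R′ T)² amounts to
    -- s² δ < (R′² - W²)².
    dichotomy : 0# < δ ⊎ 0# < (T - R′) * (T - R′) - δ * (Y * Y)
    dichotomy with <-cotrans 0<D (s * s * δ)
    ... | inj₁ 0<ssδ = inj₁ (square-*-positive⇒positive s 0<ssδ)
    ... | inj₂ ssδ<D = inj₂ (<-respʳ-≈ norm≈ (square-cancel-< (+-positive (*-positive 0<W 0<W) (*-positive 0<R′ 0<R′))
      (<-respʳ-≈ squares≈ (x<y⇒0<y-x ssδ<D))))
      where
      norm≈ : (W * W + R′ * R′) - (R′ + R′) * T ≈ (T - R′) * (T - R′) - δ * (Y * Y)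
      norm≈ = trans (+-congʳ (+-congʳ (sym norm≈W²)))
        (solve 4 (λ t d y q → (t :* t :- d :* (y :* y) :+ q :* q) :- (q :+ q) :* t := (t :- q) :* (t :- q) :- d :* (y :* y)) refl T δ Y R′)
      squares≈ : D - s * s * δ ≈ (W * W + R′ * R′) * (W * W + R′ * R′) - (R′ + R′) * T * ((R′ + R′) * T)
      squares≈ = begin
        D - s * s * δ
          ≈⟨ solve 4 (λ w y q d → (q :* q :- w :* w) :* (q :* q :- w :* w) :- (q :+ q) :* y :* ((q :+ q) :* y) :* d
               := (w :* w :+ q :* q) :* (w :* w :+ q :* q) :- (q :+ q) :* (q :+ q) :* (w :* w :+ d :* (y :* y))) refl W Y R′ δ ⟩
        (W * W + R′ * R′) * (W * W + R′ * R′) - (R′ + R′) * (R′ + R′) * (W * W + δ * (Y * Y))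
          ≈⟨ +-congˡ (-‿cong (*-congˡ (+-congʳ norm≈W²))) ⟨
        (W * W + R′ * R′) * (W * W + R′ * R′) - (R′ + R′) * (R′ + R′) * (T * T - δ * (Y * Y) + δ * (Y * Y))
          ≈⟨ solve 4 (λ w q t e → (w :* w :+ q :* q) :* (w :* w :+ q :* q) :- (q :+ q) :* (q :+ q) :* (t :* t :- e :+ e)
               := (w :* w :+ q :* q) :* (w :* w :+ q :* q) :- (q :+ q) :* t :* ((q :+ q) :* t)) refl W R′ T (δ * (Y * Y)) ⟩
        (W * W + R′ * R′) * (W * W + R′ * R′) - (R′ + R′) * T * ((R′ + R′) * T) ∎

-- Triviality of the quotient ring

module Collapse {c ℓ₁ ℓ₂ ℓ₃ b ℓ} (R : RealNumbers c ℓ₁ ℓ₂ ℓ₃) (k : ℕ) (1≤k : 1 ≤ k) (m : ℕ)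
  (r : RealNumbers.ℝ R) (0<r : RealNumbers._<_ R (RealNumbers.0# R) r)
  (B : CommutativeRing b ℓ)
  (ι : RealNumbers.ℝ R → CommutativeRing.Carrier B)
  (ι-isHomomorphism : IsRingHomomorphism
    (CommutativeRing.rawRing (RealNumbers.commutativeRing R)) (CommutativeRing.rawRing B) ι)
  (z : CommutativeRing.Carrier B)
  where
  open RealAlgebra R B ι ι-isHomomorphism
  open RealNumbers R using (ℝ; _<_; *-positive; <-isStrictPartialOrder; fromℕ; _⁻¹[_]; ⁻¹-inverseˡ; _#_; #⇒<⊎>)
  open ℝ using () renaming (_+_ to _+ᴿ_; _*_ to _*ᴿ_; _-_ to _-ᴿ_; -_ to -ᴿ_; _≈_ to _≈ᴿ_; 0# to 0ᴿ; 1# to 1ᴿ)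
  open ℝ^ using () renaming (_^_ to _^ᴿ_)
  open IsStrictPartialOrder <-isStrictPartialOrder using (<-respʳ-≈)
  open RealOrder R
  open PGrowth k 1≤k
  open Discriminant R k 1≤k m r 0<r
  open CommutativeRing B
  open Exp semiring using (_^_; ^-congˡ)
  open CommutativeExp commutativeSemiring using (^-distrib-*)
  open Mult ℝ.semiring using (×1-homo-*)
  open RangeSum B
  open SetoidReasoning setoid
  open IntegerCoefficients B

  p : ℕ → Carrier
  p i = ι (fromℕ (P k i))

  κ : Carrier
  κ = ι (fromℕ k)

  S : ℕ → Carrier
  S n = Σ< n λ i → p i * z ^ i

  ι-fromℕ-+ : ∀ i j → ι (fromℕ (i ℕ.+ j)) ≈ ι (fromℕ i) + ι (fromℕ j)
  ι-fromℕ-+ i j = trans (ι-cong (fromℕ-+ i j)) (ι-+ _ _)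

  ι-fromℕ-* : ∀ i j → ι (fromℕ (i ℕ.* j)) ≈ ι (fromℕ i) * ι (fromℕ j)
  ι-fromℕ-* i j = trans (ι-cong (×1-homo-* i j)) (ι-* _ _)

  ι-fromℕ-2k : ι (fromℕ (2 ℕ.* k)) ≈ κ + κ
  ι-fromℕ-2k = trans (ι-fromℕ-+ k (k ℕ.+ 0)) (+-congˡ (reflexive (≡.cong (λ l → ι (fromℕ l)) (ℕ.+-identityʳ k))))

  p-recurrence : ∀ i → p (3 ℕ.+ i) ≈ (κ + κ) * p (2 ℕ.+ i) + κ * p (1 ℕ.+ i) + p i
  p-recurrence i = begin
    p (3 ℕ.+ i)
      ≈⟨ trans (ι-fromℕ-+ (2 ℕ.* k ℕ.* P k (2 ℕ.+ i) ℕ.+ k ℕ.* P k (1 ℕ.+ i)) (P k i))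
               (+-congʳ (ι-fromℕ-+ (2 ℕ.* k ℕ.* P k (2 ℕ.+ i)) (k ℕ.* P k (1 ℕ.+ i)))) ⟩
    ι (fromℕ (2 ℕ.* k ℕ.* P k (2 ℕ.+ i))) + ι (fromℕ (k ℕ.* P k (1 ℕ.+ i))) + p i
      ≈⟨ +-congʳ (+-cong (trans (ι-fromℕ-* (2 ℕ.* k) (P k (2 ℕ.+ i))) (*-congʳ ι-fromℕ-2k)) (ι-fromℕ-* k (P k (1 ℕ.+ i)))) ⟩
    (κ + κ) * p (2 ℕ.+ i) + κ * p (1 ℕ.+ i) + p i ∎

  p0≈0 : p 0 ≈ 0#
  p0≈0 = ι-0

  p1≈1 : p 1 ≈ 1#
  p1≈1 = trans (ι-cong (ℝ.+-identityʳ 1ᴿ)) ι-1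

  S2≈z : S 2 ≈ z
  S2≈z = begin
    0# + p 0 * 1# + p 1 * (z * 1#)   ≈⟨ +-cong (+-congˡ (*-congʳ p0≈0)) (*-congʳ p1≈1) ⟩
    0# + 0# * 1# + 1# * (z * 1#)     ≈⟨ solve 1 (λ z → con (+ 0) :+ con (+ 0) :* con (+ 1) :+ con (+ 1) :* (z :* con (+ 1)) := z) refl z ⟩
    z                                ∎

  -- The generating function of P is z / (1 - 2kz - kz² - z³); this is its truncation.
  truncated-generating-function : ∀ i →
    S (2 ℕ.+ i) * (1# - (κ + κ) * z - κ * (z * z) - z * (z * z))
      ≈ z - z ^ (2 ℕ.+ i) * (p (2 ℕ.+ i) + (κ * p (1 ℕ.+ i) + p i) * z + p (1 ℕ.+ i) * (z * z))
  truncated-generating-function zero = begin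
    S 2 * (1# - (κ + κ) * z - κ * (z * z) - z * (z * z))
      ≈⟨ *-congʳ S2≈z ⟩
    z * (1# - (κ + κ) * z - κ * (z * z) - z * (z * z))
      ≈⟨ solve 2 (λ z κ → z :* (con (+ 1) :- (κ :+ κ) :* z :- κ :* (z :* z) :- z :* (z :* z))
           := z :- z :* (z :* con (+ 1)) :* ((κ :+ κ) :+ (κ :* con (+ 1) :+ con (+ 0)) :* z :+ con (+ 1) :* (z :* z))) refl z κ ⟩
    z - z ^ 2 * ((κ + κ) + (κ * 1# + 0#) * z + 1# * (z * z))
      ≈⟨ +-congˡ (-‿cong (*-congˡ (+-cong (+-cong ι-fromℕ-2k (*-congʳ (+-cong (*-congˡ p1≈1) p0≈0))) (*-congʳ p1≈1)))) ⟨
    z - z ^ 2 * (p 2 + (κ * p 1 + p 0) * z + p 1 * (z * z)) ∎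
  truncated-generating-function (suc i) = begin
    (S (2 ℕ.+ i) + p (2 ℕ.+ i) * z ^ (2 ℕ.+ i)) * Q
      ≈⟨ distribʳ Q _ _ ⟩
    S (2 ℕ.+ i) * Q + p (2 ℕ.+ i) * z ^ (2 ℕ.+ i) * Q
      ≈⟨ +-congʳ (truncated-generating-function i) ⟩
    z - z ^ (2 ℕ.+ i) * (p (2 ℕ.+ i) + (κ * p (1 ℕ.+ i) + p i) * z + p (1 ℕ.+ i) * (z * z)) + p (2 ℕ.+ i) * z ^ (2 ℕ.+ i) * Q
      ≈⟨ solve 6 (λ z w κ p₀ p₁ p₂ →
           z :- w :* (p₂ :+ (κ :* p₁ :+ p₀) :* z :+ p₁ :* (z :* z)) :+ p₂ :* w :* (con (+ 1) :- (κ :+ κ) :* z :- κ :* (z :* z) :- z :* (z :* z))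
             := z :- z :* w :* (((κ :+ κ) :* p₂ :+ κ :* p₁ :+ p₀) :+ (κ :* p₂ :+ p₁) :* z :+ p₂ :* (z :* z)))
           refl z (z ^ (2 ℕ.+ i)) κ (p i) (p (1 ℕ.+ i)) (p (2 ℕ.+ i)) ⟩
    z - z ^ (3 ℕ.+ i) * (((κ + κ) * p (2 ℕ.+ i) + κ * p (1 ℕ.+ i) + p i) + (κ * p (2 ℕ.+ i) + p (1 ℕ.+ i)) * z + p (2 ℕ.+ i) * (z * z))
      ≈⟨ +-congˡ (-‿cong (*-congˡ (+-congʳ (+-congʳ (p-recurrence i))))) ⟨
    z - z ^ (3 ℕ.+ i) * (p (3 ℕ.+ i) + (κ * p (2 ℕ.+ i) + p (1 ℕ.+ i)) * z + p (2 ℕ.+ i) * (z * z)) ∎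
    where
    Q = 1# - (κ + κ) * z - κ * (z * z) - z * (z * z)

  -- The derivative of `q` at `z`.
  ε : Carrier
  ε = ι λ₁ * z - ι β

  module _ (zⁿ≈r : z ^ (2 ℕ.+ m) ≈ ι r) (S≈0 : S (2 ℕ.+ m) ≈ 0#) where

    -- In the truncated generating function the left side vanishes with `S` and the power of `z`
    -- becomes `r`; what remains is `q(z) = 0`, solved for `z`.
    quadratic : z ≈ ι r * (ι p₂ + (κ * ι p₁ + ι p₀) * z + ι p₁ * (z * z))
    quadratic = begin
      z
        ≈⟨ solve 2 (λ z x → z := (z :- x) :+ x) refl z _ ⟩
      (z - z ^ (2 ℕ.+ m) * _) + z ^ (2 ℕ.+ m) * _
        ≈⟨ +-congʳ (trans (sym (truncated-generating-function m)) (trans (*-congʳ S≈0) (zeroˡ _))) ⟩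
      0# + z ^ (2 ℕ.+ m) * _
        ≈⟨ trans (+-identityˡ _) (*-congʳ zⁿ≈r) ⟩
      ι r * (ι p₂ + (κ * ι p₁ + ι p₀) * z + ι p₁ * (z * z)) ∎

    ι-β : ι β ≈ 1# - ι r * (κ * ι p₁ + ι p₀)
    ι-β = trans (ι-sub _ _) (+-cong ι-1 (-‿cong (trans (ι-* _ _) (*-congˡ (trans (ι-+ _ _) (+-congʳ (ι-* _ _)))))))

    ι-λ : ∀ x → ι ((r +ᴿ r) *ᴿ x) ≈ (ι r + ι r) * ι x
    ι-λ x = trans (ι-* _ _) (*-congʳ (ι-+ _ _))

    ε²≈δ : ε * ε ≈ ι δ
    ε²≈δ = begin
      ε * ε
        ≈⟨ *-cong ε≈ ε≈ ⟩
      ((ρ + ρ) * x₁ * z - (1# - ρ * γ)) * ((ρ + ρ) * x₁ * z - (1# - ρ * γ))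
        -- The last summand is `2 λ₁ q(z)`, with `4 r p₁ = 2 λ₁`.
        ≈⟨ solve 5 (λ z ρ γ x₁ x₂ → ((ρ :+ ρ) :* x₁ :* z :- (con (+ 1) :- ρ :* γ)) :* ((ρ :+ ρ) :* x₁ :* z :- (con (+ 1) :- ρ :* γ))
             := ((con (+ 1) :- ρ :* γ) :* (con (+ 1) :- ρ :* γ) :- (ρ :+ ρ) :* x₁ :* ((ρ :+ ρ) :* x₂))
                :+ con (+ 4) :* (ρ :* x₁) :* (ρ :* (x₂ :+ γ :* z :+ x₁ :* (z :* z)) :- z)) refl z ρ γ x₁ x₂ ⟩
      ((1# - ρ * γ) * (1# - ρ * γ) - (ρ + ρ) * x₁ * ((ρ + ρ) * x₂)) + _ * (ρ * (x₂ + γ * z + x₁ * (z * z)) - z)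
        ≈⟨ +-congˡ (trans (*-congˡ (trans (+-congʳ (sym quadratic)) (-‿inverseʳ z))) (zeroʳ _)) ⟩
      ((1# - ρ * γ) * (1# - ρ * γ) - (ρ + ρ) * x₁ * ((ρ + ρ) * x₂)) + 0#
        ≈⟨ +-identityʳ _ ⟩
      (1# - ρ * γ) * (1# - ρ * γ) - (ρ + ρ) * x₁ * ((ρ + ρ) * x₂)
        ≈⟨ +-cong (*-cong ι-β ι-β) (-‿cong (*-cong (ι-λ p₁) (ι-λ p₂))) ⟨
      ι β * ι β - ι λ₁ * ι λ₂
        ≈⟨ trans (ι-sub _ _) (+-cong (ι-* _ _) (-‿cong (ι-* _ _))) ⟨
      ι δ ∎
      where
      ρ = ι r
      x₁ = ι p₁
      x₂ = ι p₂
      γ = κ * ι p₁ + ι p₀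
      ε≈ : ε ≈ (ρ + ρ) * x₁ * z - (1# - ρ * γ)
      ε≈ = +-cong (*-congʳ (ι-λ p₁)) (-‿cong ι-β)

    open AdjoinedRoot δ ε ε²≈δ

    β+ε≈λ₁z : element β 1ᴿ ≈ ι λ₁ * z
    β+ε≈λ₁z = trans (+-congˡ (trans (*-congʳ ι-1) (*-identityˡ ε)))
      (solve 2 (λ b x → b :+ (x :- b) := x) refl (ι β) (ι λ₁ * z))

    λ₁⁻¹ : ℝ
    λ₁⁻¹ = λ₁ ⁻¹[ 0<λ₁ ]

    λ₁⁻¹λ₁x≈x : ∀ x → ι λ₁⁻¹ * (ι λ₁ * x) ≈ x
    λ₁⁻¹λ₁x≈x x = begin
      ι λ₁⁻¹ * (ι λ₁ * x)       ≈⟨ *-assoc _ _ x ⟨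
      ι λ₁⁻¹ * ι λ₁ * x         ≈⟨ *-congʳ (trans (sym (ι-* _ _)) (trans (ι-cong (⁻¹-inverseˡ λ₁ 0<λ₁)) ι-1)) ⟩
      1# * x                    ≈⟨ *-identityˡ x ⟩
      x                         ∎

    TP-p : ∀ i → TotallyPositive (p (suc i))
    TP-p i = TP-ι (fromℕ-P-positive i)

    module _ (0<δ : 0ᴿ < δ) where

      _⊛_ : ∀ {x y} → TotallyPositive x → TotallyPositive y → TotallyPositive (x * y)
      _⊛_ = TP-* 0<δ

      _⊞_ : ∀ {x y} → TotallyPositive x → TotallyPositive y → TotallyPositive (x + y)
      _⊞_ = TP-+ 0<δ

      -- Multiplying by `λ₁` first keeps the coordinates free of division.
      TP-λ₁⁻¹ : ∀ {x y} → ι λ₁ * x ≈ y → TotallyPositive y → TotallyPositive x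
      TP-λ₁⁻¹ {x} λ₁x≈y y>0 = TP-resp-≈ (λ₁⁻¹λ₁x≈x x) (TP-ι (⁻¹-positive 0<λ₁) ⊛ TP-resp-≈ (sym λ₁x≈y) y>0)

      -- Both values of z are positive, and so is S.
      positive-roots : 0ᴿ < β → 1# ≈ 0#
      positive-roots 0<β = TP-0⇒trivial (TP-resp-≈ S≈0 (S>0 m))
        where
        z>0 : TotallyPositive z
        -- The norm of `β + ε` is `λ₁ λ₂`: the roots have a positive product, and `β > 0` makes
        -- their sum positive too.
        z>0 = TP-λ₁⁻¹ (sym β+ε≈λ₁z) (β , 1ᴿ , refl , 0<β , <-respʳ-≈
          (ℝᶻ.solve 3 (λ b s t → let module ᴿ = ℝᶻ in s ᴿ.:* t ᴿ.:= b ᴿ.:* b ᴿ.:- (b ᴿ.:* b ᴿ.:- s ᴿ.:* t) ᴿ.:* (ᴿ.con (+ 1) ᴿ.:* ᴿ.con (+ 1))) ℝ.refl β λ₁ λ₂)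
          (*-positive 0<λ₁ 0<λ₂))
        S>0 : ∀ i → TotallyPositive (S (2 ℕ.+ i))
        S>0 zero    = TP-resp-≈ (sym S2≈z) z>0
        S>0 (suc i) = S>0 i ⊞ (TP-p (suc i) ⊛ TP-^ 0<δ z>0 (2 ℕ.+ i))

      -- Both values of z are less than -1.  If n is odd, then zⁿ < 0 < r; if n is even,
      -- then S < 0, because the terms of S other than z pair up into
      -- P_{2j} z^{2j} + P_{2j+1} z^{2j+1} < 0.
      negative-roots : β < 0ᴿ → 1# ≈ 0#
      negative-roots β<0 with parity m
        where
        -z-1>0 : TotallyPositive (- z - 1#)
        -- Both roots lie below -1 because their midpoint does and `q(-1)` is positive; these are
        -- the two conditions on `(- β - λ₁) - ε`.
        -z-1>0 = TP-λ₁⁻¹ λ₁[-z-1]≈ (-ᴿ β -ᴿ λ₁ , -ᴿ 1ᴿ , refl , λ₁<-β 0<δ β<0 ,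
          <-respʳ-≈ (ℝ.+-congˡ (ℝ.-‿cong (ℝ.sym (ℝ.trans (ℝ.*-congˡ (-x*-x≈x*x 1ᴿ)) (ℝ.trans (ℝ.*-congˡ (ℝ.*-identityˡ 1ᴿ)) (ℝ.*-identityʳ δ)))))) (δ<[β+λ₁]² 0<δ))
          where
          λ₁[-z-1]≈ : ι λ₁ * (- z - 1#) ≈ element (-ᴿ β -ᴿ λ₁) (-ᴿ 1ᴿ)
          λ₁[-z-1]≈ = begin
            ι λ₁ * (- z - 1#)
              ≈⟨ solve 3 (λ l z b → l :* (:- z :- con (+ 1)) := (:- b :- l) :+ :- con (+ 1) :* (l :* z :- b)) refl (ι λ₁) z (ι β) ⟩
            (- ι β - ι λ₁) + - 1# * ε
              ≈⟨ +-cong (trans (ι-sub _ _) (+-congʳ (ι-neg β))) (*-congʳ (trans (ι-neg 1ᴿ) (-‿cong ι-1))) ⟨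
            element (-ᴿ β -ᴿ λ₁) (-ᴿ 1ᴿ) ∎
        -z>0 : TotallyPositive (- z)
        -z>0 = TP-resp-≈ (solve 1 (λ z → :- z :- con (+ 1) :+ con (+ 1) := :- z) refl z)
          (-z-1>0 ⊞ TP-resp-≈ ι-1 (TP-ι 0<1))
        -- Write `q (-z) - p` as `p (-z - 1) + (q - p) (-z)` for consecutive `p < q`.
        pair>0 : ∀ i → TotallyPositive (p (2 ℕ.+ i) * - z - p (1 ℕ.+ i))
        pair>0 i = TP-resp-≈ (trans (+-congˡ (*-congʳ (ι-sub _ _)))
          (solve 3 (λ s p q → p :* (:- s :- con (+ 1)) :+ (q :- p) :* :- s := q :* :- s :- p) refl z (p (1 ℕ.+ i)) (p (2 ℕ.+ i))))
          ((TP-p i ⊛ -z-1>0) ⊞ (TP-ι (fromℕ-mono-< (P-increasing i)) ⊛ -z>0))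
        -- The first case belongs to even exponents. At odd ones the newest term of `S` still waits
        -- for its partner, so the previous even stage is remembered instead.
        parity : ∀ i → (TotallyPositive (z ^ (2 ℕ.+ i)) × TotallyPositive (- S (2 ℕ.+ i)))
                     ⊎ (TotallyPositive (- z ^ (2 ℕ.+ i)) × TotallyPositive (z ^ (1 ℕ.+ i)) × TotallyPositive (- S (1 ℕ.+ i)))
        parity zero = inj₁ (TP-resp-≈ (solve 1 (λ z → :- z :* :- z := z :* (z :* con (+ 1))) refl z) (-z>0 ⊛ -z>0)
                           , TP-resp-≈ (-‿cong (sym S2≈z)) -z>0)
        parity (suc i) with parity i
        ... | inj₁ (zⁱ>0 , -S>0) =
          inj₂ (TP-resp-≈ (solve 2 (λ z w → w :* :- z := :- (z :* w)) refl z _) (zⁱ>0 ⊛ -z>0) , zⁱ>0 , -S>0)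
        ... | inj₂ (-zⁱ>0 , zⁱ⁻¹>0 , -S>0) =
          inj₁ (TP-resp-≈ (solve 2 (λ z w → :- w :* :- z := z :* w) refl z _) (-zⁱ>0 ⊛ -z>0)
               , TP-resp-≈ (solve 5 (λ z w s p q → :- s :+ (q :* :- z :- p) :* w := :- (s :+ p :* w :+ q :* (z :* w))) refl z (z ^ (1 ℕ.+ i)) _ _ _)
                   (-S>0 ⊞ (pair>0 i ⊛ zⁱ⁻¹>0)))
      ... | inj₁ (_ , -S>0) = TP-0⇒trivial (TP-resp-≈ (trans (-‿cong S≈0) (RingProperties.-0#≈0# ring)) -S>0)
      ... | inj₂ (-zⁿ>0 , _) = TP-0⇒trivial (TP-resp-≈ (trans (+-congˡ (-‿cong zⁿ≈r)) (-‿inverseʳ (ι r))) (TP-ι 0<r ⊞ -zⁿ>0))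

      real-roots : 1# ≈ 0#
      real-roots = [ negative-roots , positive-roots ]′ (#⇒<⊎> (β#0 0<δ))

    norm-β≈λ₁λ₂ : norm β 1ᴿ ≈ᴿ λ₁ *ᴿ λ₂
    norm-β≈λ₁λ₂ = ℝᶻ.solve 3 (λ b s t → let module ᴿ = ℝᶻ in
      b ᴿ.:* b ᴿ.:- (b ᴿ.:* b ᴿ.:- s ᴿ.:* t) ᴿ.:* (ᴿ.con (+ 1) ᴿ.:* ᴿ.con (+ 1)) ᴿ.:= s ᴿ.:* t) ℝ.refl β λ₁ λ₂

    -- The exponent is a variable here, because powers with exponent 2 + m unfold.
    module _ (n : ℕ) (zⁿ≈r : z ^ n ≈ ι r)
             (W : ℝ) (0<W : 0ᴿ < W) (R′#W : (λ₁ ^ᴿ n *ᴿ r) # W) (W²≈ : W *ᴿ W ≈ᴿ (λ₁ *ᴿ λ₂) ^ᴿ n)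
             (T Y : ℝ) (T+Yε≈ : element β 1ᴿ ^ n ≈ element T Y) (norm≈ : norm T Y ≈ᴿ norm β 1ᴿ ^ᴿ n)
             where

      R′ : ℝ
      R′ = λ₁ ^ᴿ n *ᴿ r

      -- The power `(λ₁ z)ⁿ` is evaluated twice: in coordinates, and through `zⁿ = r`.
      T-R′+Yε≈0 : element (T -ᴿ R′) Y ≈ 0#
      T-R′+Yε≈0 = begin
        element (T -ᴿ R′) Y                       ≈⟨ +-congʳ (ι-sub T R′) ⟩
        ι T - ι R′ + ι Y * ε                      ≈⟨ solve 3 (λ t q y → t :- q :+ y := (t :+ y) :- q) refl (ι T) (ι R′) (ι Y * ε) ⟩
        element T Y - ι R′                        ≈⟨ +-congʳ T+Yε≈ ⟨
        element β 1ᴿ ^ n - ι R′                   ≈⟨ +-congʳ (^-congˡ n β+ε≈λ₁z) ⟩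
        (ι λ₁ * z) ^ n - ι R′                     ≈⟨ +-congʳ (^-distrib-* (ι λ₁) z n) ⟩
        ι λ₁ ^ n * z ^ n - ι R′                   ≈⟨ +-congʳ (*-cong (sym (ι-^ λ₁ n)) zⁿ≈r) ⟩
        ι (λ₁ ^ᴿ n) * ι r - ι R′                  ≈⟨ +-congʳ (sym (ι-* _ r)) ⟩
        ι R′ - ι R′                               ≈⟨ -‿inverseʳ _ ⟩
        0#                                        ∎

      trivial-from-power : 1# ≈ 0#
      trivial-from-power = [ real-roots , (λ 0<norm → norm-positive⇒trivial 0<norm T-R′+Yε≈0) ]′
        (Dichotomy.dichotomy T Y R′ W (*-positive (^-positive 0<λ₁ n) 0<r) 0<W R′#W
          (ℝ.trans norm≈ (ℝ.trans (ℝ^.^-congˡ n norm-β≈λ₁λ₂) (ℝ.sym W²≈))))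

    collapse : ∀ n W → z ^ n ≈ ι r → 0ᴿ < W → (λ₁ ^ᴿ n *ᴿ r) # W → W *ᴿ W ≈ᴿ (λ₁ *ᴿ λ₂) ^ᴿ n → 1# ≈ 0#
    collapse n W zⁿ≈r 0<W R′#W W²≈ =
      let T , Y , T+Yε≈ , norm≈ = element-^ β 1ᴿ n
      in trivial-from-power n zⁿ≈r W 0<W R′#W W²≈ T Y T+Yε≈ norm≈

-- From the quotient ring to the matrix

module _ {c ℓ₁ ℓ₂ ℓ₃} (R : RealNumbers c ℓ₁ ℓ₂ ℓ₃) (k : ℕ) (1≤k : 1 ≤ k) (m : ℕ) where
  open RealNumbers R

  private
    n : ℕ
    n = suc (suc m)

  -- `W` stands for the square root of `(λ₁ λ₂)ⁿ`, and the apartness is the condition on `r` with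
  -- denominators cleared. Any real algebra with an `n`-th root `z` of `r` will do; it is applied to
  -- the operator ring with `z = E`.
  generating-polynomial-invertible : ∀ {b ℓ} (A : CommutativeRing b ℓ) (ι : ℝ → CommutativeRing.Carrier A) →
    IsRingHomomorphism (CommutativeRing.rawRing commutativeRing) (CommutativeRing.rawRing A) ι →
    let open CommutativeRing A using () renaming (_≈_ to _≈ᴬ_; _*_ to _*ᴬ_; 1# to 1ᴬ)
        open Exp (CommutativeRing.semiring A) using () renaming (_^_ to _^ᴬ_)
        open RangeSum A
    in ∀ z r (0<r : 0# < r) W → 0# < W →
    (((r + r) * fromℕ (P k (suc m))) ^ n * r) # W →
    W * W ≈ ((r + r) * fromℕ (P k (suc m)) * ((r + r) * fromℕ (P k n))) ^ n →
    z ^ᴬ n ≈ᴬ ι r →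
    ∃[ g ] (Σ< n λ i → ι (fromℕ (P k i)) *ᴬ z ^ᴬ i) *ᴬ g ≈ᴬ 1ᴬ
  generating-polynomial-invertible A ι ι-isHomomorphism z r 0<r W 0<W R′#W W²≈ zⁿ≈r =
    trivial⇒invertible (collapse zⁿ≋r S≋0 n W zⁿ≋r 0<W R′#W W²≈)
    where
    open CommutativeRing A using () renaming (_*_ to _*ᴬ_; 0# to 0ᴬ)
    open Exp (CommutativeRing.semiring A) using () renaming (_^_ to _^ᴬ_)
    f : CommutativeRing.Carrier A
    f = RangeSum.Σ< A n λ i → ι (fromℕ (P k i)) *ᴬ z ^ᴬ i
    open PrincipalQuotient A f
    module Q = CommutativeRing quotient
    open Exp Q.semiring using () renaming (_^_ to _^≋_)
    ι-mod-f-isHomomorphism : IsRingHomomorphism (CommutativeRing.rawRing commutativeRing) Q.rawRing ι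
    ι-mod-f-isHomomorphism = isRingHomomorphism (λ {x} {y} {z} → Q.trans {x} {y} {z}) ι-isHomomorphism projection-isRingHomomorphism
    open Collapse R k 1≤k m r 0<r quotient ι
      ι-mod-f-isHomomorphism z
      using (S; collapse)
    zⁿ≋r : (z ^≋ n) ≋ ι r
    zⁿ≋r = ≡.subst (_≋ ι r) (≡.sym (^-quotient z n)) (≈⇒≋ zⁿ≈r)
    S≡ : ∀ j → S j ≡ RangeSum.Σ< A j (λ i → ι (fromℕ (P k i)) *ᴬ z ^ᴬ i)
    S≡ j = Σ<-quotient j λ i → ≡.cong (ι (fromℕ (P k i)) *ᴬ_) (^-quotient z i)
    S≋0 : S n ≋ 0ᴬ
    S≋0 = ≡.subst (_≋ 0ᴬ) (≡.sym (S≡ n)) f≋0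

  Circ-P-invertible : ∀ r (0<r : 0# < r) W → 0# < W →
    (((r + r) * fromℕ (P k (suc m))) ^ n * r) # W →
    W * W ≈ ((r + r) * fromℕ (P k (suc m)) * ((r + r) * fromℕ (P k n))) ^ n →
    IsInvertible (Circ {n} r (λ i → fromℕ (P k (toℕ i))))
  Circ-P-invertible r 0<r W 0<W R′#W W²≈ = Circ-invertible (λ i → fromℕ (P k i)) (proj₁ inverse) (proj₂ inverse)
    where
    open ShiftOperators commutativeRing n r
    inverse = generating-polynomial-invertible operatorRing scalar scalar-isRingHomomorphism E r 0<r W 0<W R′#W W²≈ E^n≗r

theorem5 : ∀ {c ℓ₁ ℓ₂ ℓ₃} (R : RealNumbers c ℓ₁ ℓ₂ ℓ₃) →
    let open RealNumbers R in
    (k n : ℕ) → 1 ≤ k → 2 ≤ n →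
    (α : ℝ) (0<α : 0# < α) → φ k α ≈ 0# →
    (u v : ℝ) (u-def : IsHalfPower (fromℕ (P k (n ∸ 1))) n u) (v-def : IsHalfPower (fromℕ (P k n)) n v) →
    (r : ℝ) → 0# < r →
    r # α ⁻¹[ 0<α ] →
    r # u ⁻¹[ proj₁ u-def ] * v →
    IsInvertible (Circ {n} r (λ i → fromℕ (P k (toℕ i))))
theorem5 R k (suc (suc m)) 1≤k (s≤s (s≤s z≤n)) _ _ _ u v (0<u , u²≈) (0<v , v²≈) r 0<r _ r#u⁻¹v =
  Circ-P-invertible R k 1≤k m r 0<r W
    (*-positive (^-positive 0<2r n) (*-positive 0<u 0<v))
    (#-scaled (*-positive (^-positive 0<2r n) (*-positive 0<u 0<u)) λ₁ⁿr≈ W≈ r#u⁻¹v)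
    W²≈
  where
  open RealNumbers R
  open RealOrder R
  open IntegerCoefficients commutativeRing using (solve; _:=_; _:*_)
  open CommutativeExp (CommutativeRing.commutativeSemiring commutativeRing) using (^-distrib-*)
  open SetoidReasoning (CommutativeRing.setoid commutativeRing)
  n : ℕ
  n = suc (suc m)
  p₁ p₂ : ℝ
  p₁ = fromℕ (P k (suc m))
  p₂ = fromℕ (P k n)
  0<2r : 0# < r + r
  0<2r = +-positive 0<r 0<r
  -- The given half powers already provide the square root: `u²` and `v²` are the `n`-th powers of
  -- `p₁` and `p₂`.
  W : ℝ
  W = (r + r) ^ n * (u * v)
  -- Multiplication by `(r + r)ⁿ u²` clears the inverse of `u` in the hypothesis on `r`; this and
  -- `W≈` identify the two sides.
  λ₁ⁿr≈ : ((r + r) * p₁) ^ n * r ≈ (r + r) ^ n * (u * u) * r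
  λ₁ⁿr≈ = *-congʳ (trans (^-distrib-* (r + r) p₁ n) (*-congˡ (sym u²≈)))
  W≈ : W ≈ (r + r) ^ n * (u * u) * (u ⁻¹[ 0<u ] * v)
  W≈ = begin
    (r + r) ^ n * (u * v)                             ≈⟨ *-congˡ (*-congˡ (*-identityˡ v)) ⟨
    (r + r) ^ n * (u * (1# * v))                      ≈⟨ *-congˡ (*-congˡ (*-congʳ (⁻¹-inverseˡ u 0<u))) ⟨
    (r + r) ^ n * (u * (u ⁻¹[ 0<u ] * u * v))
      ≈⟨ solve 4 (λ x u i v → x :* (u :* (i :* u :* v)) := x :* (u :* u) :* (i :* v)) refl _ u (u ⁻¹[ 0<u ]) v ⟩
    (r + r) ^ n * (u * u) * (u ⁻¹[ 0<u ] * v)         ∎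
  W²≈ : W * W ≈ ((r + r) * p₁ * ((r + r) * p₂)) ^ n
  W²≈ = begin
    (r + r) ^ n * (u * v) * ((r + r) ^ n * (u * v))
      ≈⟨ solve 3 (λ x u v → x :* (u :* v) :* (x :* (u :* v)) := x :* (u :* u) :* (x :* (v :* v))) refl _ u v ⟩
    (r + r) ^ n * (u * u) * ((r + r) ^ n * (v * v))   ≈⟨ *-cong (*-congˡ u²≈) (*-congˡ v²≈) ⟩
    (r + r) ^ n * p₁ ^ n * ((r + r) ^ n * p₂ ^ n)     ≈⟨ *-cong (^-distrib-* (r + r) p₁ n) (^-distrib-* (r + r) p₂ n) ⟨
    ((r + r) * p₁) ^ n * ((r + r) * p₂) ^ n           ≈⟨ ^-distrib-* _ _ n ⟨
    ((r + r) * p₁ * ((r + r) * p₂)) ^ n               ∎
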